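{- Let $j\in\mathbb{Z}_{\ge 0}$. Then $$\sum_{n=1}^{\infty}\frac{\binom{2n}{n}}{n^24^n}\,\zeta_n^{\star}(\{2\}_j)=2\sum_{k=0}^{2j+2}(-1)^k\eta(k)\,\eta(2j-k+2),$$ where $\eta(0)=\frac12$ by convention.
   Context: For $n\in\mathbb{Z}_{>0}$ and $j\in\mathbb{Z}_{\ge 0}$, the multiple harmonic star sum is $$\zeta_n^{\star}(\{2\}_j):=\sum_{n\ge n_1\ge\cdots\ge n_j\ge 1}\prod_{i=1}^j\frac{1}{n_i^2},$$ where the $n_i$ are integers, with the convention $\zeta_n^{\star}(\{2\}_0)=\zeta_n^\star(\emptyset)=1$. $\eta$ is the Dirichlet eta function, $\eta(s)=\sum_{n=1}^\infty\frac{(-1)^{n-1}}{n^s}$ for $\Re(s)>0$ (so $\eta(1)=\ln 2$). -}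

module Defs where

open import Data.Nat as ℕ using (ℕ; zero; suc; NonZero; s≤s; z≤n)
import Data.Nat.Properties as ℕₚ
open import Data.Nat.Combinatorics using (_C_)
open import Data.Integer as ℤ using (+_; +[1+_]; -[1+_])
import Data.Integer.Properties as ℤₚ
open import Data.Rational as ℚ using (ℚ; mkℚ; 0ℚ; 1ℚ; ½; toℚᵘ; fromℚᵘ)
import Data.Rational.Properties as ℚₚ
import Data.Rational.Unnormalised as ℚᵘ
import Data.Rational.Unnormalised.Properties as ℚᵘₚ
open import Data.Rational.Solver using (module +-*-Solver)
import Algebra.Definitions.RawSemiring
open import Data.Product using (Σ; Σ-syntax; ∃-syntax; _×_; _,_; proj₁; proj₂)
open import Data.Sum using (inj₁; inj₂)
open import Relation.Binary.PropositionalEquality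
  using (_≡_; refl; sym; trans; cong; cong₂; subst; subst₂)

open Algebra.Definitions.RawSemiring ℚ.+-*-rawSemiring public
  using () renaming (_^_ to _^ℚ_)

Cauchy : (ℕ → ℚ) → Set
Cauchy x = ∀ ε → 0ℚ ℚ.< ε →
  ∃[ N ] (∀ m n → N ℕ.≤ m → N ℕ.≤ n → ℚ.∣ x m ℚ.- x n ∣ ℚ.< ε)

-- Reals are Cauchy sequences of rationals, not quotiented: two of them
-- denote the same number when their difference tends to 0.  Order and
-- limits below do not depend on the representative.
record ℝ : Set where
  constructor mkℝ
  field
    seq    : ℕ → ℚ
    cauchy : Cauchy seq

open ℝ public

private
  module _ where
    open +-*-Solver

    swap-id : ∀ p q → p ℚ.- q ≡ ℚ.- (q ℚ.- p)
    swap-id = solve 2 (λ p q → p :- q := :- (q :- p)) refl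

    add-sub : ∀ a b → a ℚ.+ b ℚ.- b ≡ a
    add-sub = solve 2 (λ a b → a :+ b :- b := a) refl

    sub-add : ∀ a b → a ℚ.- b ℚ.+ b ≡ a
    sub-add = solve 2 (λ a b → a :- b :+ b := a) refl

    neg-sub : ∀ a b → b ℚ.- a ≡ ℚ.- a ℚ.- (ℚ.- b)
    neg-sub = solve 2 (λ a b → b :- a := :- a :- (:- b)) refl

    +-diff : ∀ a b c d → (a ℚ.- b) ℚ.+ (c ℚ.- d) ≡ (a ℚ.+ c) ℚ.- (b ℚ.+ d)
    +-diff = solve 4 (λ a b c d → (a :- b) :+ (c :- d) := (a :+ c) :- (b :+ d)) refl

    *-diff : ∀ a b c d →
      a ℚ.* (c ℚ.- d) ℚ.+ d ℚ.* (a ℚ.- b) ≡ a ℚ.* c ℚ.- b ℚ.* d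
    *-diff =
      solve 4 (λ a b c d → a :* (c :- d) :+ d :* (a :- b) := a :* c :- b :* d) refl

    tail-step : ∀ a b c r → a ℚ.- b ≡ (a ℚ.- (b ℚ.+ c ℚ.* r)) ℚ.+ c ℚ.* r
    tail-step =
      solve 4 (λ a b c r → a :- b := (a :- (b :+ c :* r)) :+ c :* r) refl

    alternate : ∀ c t r → (ℚ.- c) ℚ.* t ℚ.+ c ℚ.* r ≡ c ℚ.* (r ℚ.- t)
    alternate = solve 3 (λ c t r → (:- c) :* t :+ c :* r := c :* (r :- t)) refl

  half-pos : ∀ {ε} → 0ℚ ℚ.< ε → 0ℚ ℚ.< ε ℚ.* ½
  half-pos {ε} 0<ε =
    subst (ℚ._< ε ℚ.* ½) (ℚₚ.*-zeroˡ ½) (ℚₚ.*-monoˡ-<-pos ½ 0<ε)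

  half+half : ∀ ε → ε ℚ.* ½ ℚ.+ ε ℚ.* ½ ≡ ε
  half+half ε =
    trans (sym (ℚₚ.*-distribˡ-+ ε ½ ½)) (ℚₚ.*-identityʳ ε)

  ∣-∣-swap : ∀ p q → ℚ.∣ p ℚ.- q ∣ ≡ ℚ.∣ q ℚ.- p ∣
  ∣-∣-swap p q = trans (cong ℚ.∣_∣ (swap-id p q)) (ℚₚ.∣-p∣≡∣p∣ (q ℚ.- p))

  0≤q-p : ∀ {p q} → p ℚ.≤ q → 0ℚ ℚ.≤ q ℚ.- p
  0≤q-p {p} {q} p≤q =
    subst (ℚ._≤ q ℚ.- p) (ℚₚ.+-inverseʳ p) (ℚₚ.+-monoˡ-≤ (ℚ.- p) p≤q)

  q-p≤q : ∀ {p q} → 0ℚ ℚ.≤ p → q ℚ.- p ℚ.≤ q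
  q-p≤q {p} {q} 0≤p =
    subst (q ℚ.- p ℚ.≤_) (ℚₚ.+-identityʳ q)
      (ℚₚ.+-monoʳ-≤ q (ℚₚ.neg-antimono-≤ 0≤p))

  ∣p∣-∣q∣≤∣p-q∣ : ∀ p q → ℚ.∣ p ∣ ℚ.- ℚ.∣ q ∣ ℚ.≤ ℚ.∣ p ℚ.- q ∣
  ∣p∣-∣q∣≤∣p-q∣ p q = subst (ℚ.∣ p ∣ ℚ.- ℚ.∣ q ∣ ℚ.≤_)
    (add-sub ℚ.∣ p ℚ.- q ∣ ℚ.∣ q ∣)
    (ℚₚ.+-monoˡ-≤ (ℚ.- ℚ.∣ q ∣)
      (subst (λ r → ℚ.∣ r ∣ ℚ.≤ ℚ.∣ p ℚ.- q ∣ ℚ.+ ℚ.∣ q ∣) (sub-add p q)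
        (ℚₚ.∣p+q∣≤∣p∣+∣q∣ (p ℚ.- q) q)))

  ∣∣p∣-∣q∣∣≤∣p-q∣ : ∀ p q → ℚ.∣ ℚ.∣ p ∣ ℚ.- ℚ.∣ q ∣ ∣ ℚ.≤ ℚ.∣ p ℚ.- q ∣
  ∣∣p∣-∣q∣∣≤∣p-q∣ p q with ℚₚ.∣p∣≡p∨∣p∣≡-p (ℚ.∣ p ∣ ℚ.- ℚ.∣ q ∣)
  ... | inj₁ e = subst (ℚ._≤ ℚ.∣ p ℚ.- q ∣) (sym e) (∣p∣-∣q∣≤∣p-q∣ p q)
  ... | inj₂ e = subst₂ ℚ._≤_
    (trans (swap-id ℚ.∣ q ∣ ℚ.∣ p ∣) (sym e)) (∣-∣-swap q p) (∣p∣-∣q∣≤∣p-q∣ q p)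

  cauchy-const : ∀ q → Cauchy (λ _ → q)
  cauchy-const q ε 0<ε = 0 , λ _ _ _ _ →
    subst (λ r → ℚ.∣ r ∣ ℚ.< ε) (sym (ℚₚ.+-inverseʳ q)) 0<ε

  cauchy-neg : ∀ {x} → Cauchy x → Cauchy (λ n → ℚ.- x n)
  cauchy-neg {x} cx ε 0<ε with cx ε 0<ε
  ... | N , h = N , λ m n N≤m N≤n →
    subst (ℚ._< ε)
      (trans (∣-∣-swap (x m) (x n))
        (cong ℚ.∣_∣ (neg-sub (x m) (x n))))
      (h m n N≤m N≤n)

  cauchy-abs : ∀ {x} → Cauchy x → Cauchy (λ n → ℚ.∣ x n ∣)
  cauchy-abs {x} cx ε 0<ε with cx ε 0<ε
  ... | N , h = N , λ m n N≤m N≤n →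
    ℚₚ.≤-<-trans (∣∣p∣-∣q∣∣≤∣p-q∣ (x m) (x n)) (h m n N≤m N≤n)

  cauchy-+ : ∀ {x y} → Cauchy x → Cauchy y → Cauchy (λ n → x n ℚ.+ y n)
  cauchy-+ {x} {y} cx cy ε 0<ε
    with cx (ε ℚ.* ½) (half-pos 0<ε) | cy (ε ℚ.* ½) (half-pos 0<ε)
  ... | M , h | N , k = M ℕ.⊔ N , λ m n p q →
    subst₂ (λ r e → ℚ.∣ r ∣ ℚ.< e)
      (+-diff (x m) (x n) (y m) (y n))
      (half+half ε)
      (ℚₚ.≤-<-trans (ℚₚ.∣p+q∣≤∣p∣+∣q∣ (x m ℚ.- x n) (y m ℚ.- y n))
        (ℚₚ.+-mono-<
          (h m n (ℕₚ.m⊔n≤o⇒m≤o M N p) (ℕₚ.m⊔n≤o⇒m≤o M N q))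
          (k m n (ℕₚ.m⊔n≤o⇒n≤o M N p) (ℕₚ.m⊔n≤o⇒n≤o M N q))))

  0<1 : 0ℚ ℚ.< 1ℚ
  0<1 = ℚₚ.positive⁻¹ 1ℚ

  eventually-bounded : ∀ {x} → Cauchy x →
    Σ[ B ∈ ℚ ] 0ℚ ℚ.< B × (∃[ N ] (∀ n → N ℕ.≤ n → ℚ.∣ x n ∣ ℚ.≤ B))
  eventually-bounded {x} cx with cx 1ℚ 0<1
  ... | N , h = 1ℚ ℚ.+ ℚ.∣ x N ∣
              , ℚₚ.+-mono-<-≤ 0<1 (ℚₚ.0≤∣p∣ (x N))
              , N
              , λ n N≤n → ℚₚ.≤-trans
                  (subst (λ r → ℚ.∣ r ∣ ℚ.≤ ℚ.∣ x n ℚ.- x N ∣ ℚ.+ ℚ.∣ x N ∣)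
                    (sub-add (x n) (x N))
                    (ℚₚ.∣p+q∣≤∣p∣+∣q∣ (x n ℚ.- x N) (x N)))
                  (ℚₚ.+-monoˡ-≤ ℚ.∣ x N ∣ (ℚₚ.<⇒≤ (h n N N≤n ℕₚ.≤-refl)))

  -- ∣p∣ ≤ B and ∣d∣ < ε/B give ∣p d∣ < ε
  scale : ∀ B → 0ℚ ℚ.< B → ∀ ε → 0ℚ ℚ.< ε →
    Σ[ δ ∈ ℚ ] 0ℚ ℚ.< δ ×
      (∀ p d → ℚ.∣ p ∣ ℚ.≤ B → ℚ.∣ d ∣ ℚ.< δ → ℚ.∣ p ℚ.* d ∣ ℚ.< ε)
  scale B 0<B ε 0<ε = δ , ℚₚ.positive⁻¹ δ , bound
    where
    instance
      B-pos : ℚ.Positive B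
      B-pos = ℚ.positive 0<B
      B-nonZero : ℚ.NonZero B
      B-nonZero = ℚₚ.pos⇒nonZero B
      ε-pos : ℚ.Positive ε
      ε-pos = ℚ.positive 0<ε
      1/B-pos : ℚ.Positive (ℚ.1/ B)
      1/B-pos = ℚₚ.1/pos⇒pos B

    δ : ℚ
    δ = ε ℚ.* ℚ.1/ B

    instance
      δ-pos : ℚ.Positive δ
      δ-pos = ℚₚ.pos*pos⇒pos ε (ℚ.1/ B)

    Bδ≡ε : B ℚ.* δ ≡ ε
    Bδ≡ε = trans (ℚₚ.*-comm B δ)
      (trans (ℚₚ.*-assoc ε (ℚ.1/ B) B)
        (trans (cong (ε ℚ.*_) (ℚₚ.*-inverseˡ B)) (ℚₚ.*-identityʳ ε)))

    bound : ∀ p d → ℚ.∣ p ∣ ℚ.≤ B → ℚ.∣ d ∣ ℚ.< δ → ℚ.∣ p ℚ.* d ∣ ℚ.< ε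
    bound p d p≤B d<δ =
      subst₂ ℚ._<_ (sym (ℚₚ.∣p*q∣≡∣p∣*∣q∣ p d)) Bδ≡ε
        (ℚₚ.≤-<-trans
          (ℚₚ.*-monoʳ-≤-nonNeg ℚ.∣ d ∣ {{ℚₚ.∣-∣-nonNeg d}} p≤B)
          (ℚₚ.*-monoʳ-<-pos B d<δ))

  *-close : ∀ a b c d {ε} → ℚ.∣ a ℚ.* (c ℚ.- d) ∣ ℚ.< ε ℚ.* ½ →
    ℚ.∣ d ℚ.* (a ℚ.- b) ∣ ℚ.< ε ℚ.* ½ → ℚ.∣ a ℚ.* c ℚ.- b ℚ.* d ∣ ℚ.< ε
  *-close a b c d {ε} h k =
    subst (λ r → ℚ.∣ r ∣ ℚ.< ε) (*-diff a b c d)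
      (subst (ℚ.∣ a ℚ.* (c ℚ.- d) ℚ.+ d ℚ.* (a ℚ.- b) ∣ ℚ.<_) (half+half ε)
        (ℚₚ.≤-<-trans
          (ℚₚ.∣p+q∣≤∣p∣+∣q∣ (a ℚ.* (c ℚ.- d)) (d ℚ.* (a ℚ.- b)))
          (ℚₚ.+-mono-< h k)))

  cauchy-* : ∀ {x y} → Cauchy x → Cauchy y → Cauchy (λ n → x n ℚ.* y n)
  cauchy-* {x} {y} cx cy ε 0<ε =
    let A , 0<A , K , x≤A = eventually-bounded cx
        B , 0<B , L , y≤B = eventually-bounded cy
        δ , 0<δ , f = scale A 0<A (ε ℚ.* ½) (half-pos 0<ε)
        γ , 0<γ , g = scale B 0<B (ε ℚ.* ½) (half-pos 0<ε)
        M , h = cy δ 0<δ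
        N , k = cx γ 0<γ
    in (K ℕ.⊔ L) ℕ.⊔ (M ℕ.⊔ N) , λ m n p q →
    let p₁ = ℕₚ.m⊔n≤o⇒m≤o (K ℕ.⊔ L) (M ℕ.⊔ N) p
        p₂ = ℕₚ.m⊔n≤o⇒n≤o (K ℕ.⊔ L) (M ℕ.⊔ N) p
        q₁ = ℕₚ.m⊔n≤o⇒m≤o (K ℕ.⊔ L) (M ℕ.⊔ N) q
        q₂ = ℕₚ.m⊔n≤o⇒n≤o (K ℕ.⊔ L) (M ℕ.⊔ N) q
    in *-close (x m) (x n) (y m) (y n) {ε}
        (f (x m) (y m ℚ.- y n) (x≤A m (ℕₚ.m⊔n≤o⇒m≤o K L p₁))
          (h m n (ℕₚ.m⊔n≤o⇒m≤o M N p₂) (ℕₚ.m⊔n≤o⇒m≤o M N q₂)))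
        (g (y n) (x m ℚ.- x n) (y≤B n (ℕₚ.m⊔n≤o⇒n≤o K L q₁))
          (k m n (ℕₚ.m⊔n≤o⇒n≤o M N p₂) (ℕₚ.m⊔n≤o⇒n≤o M N q₂)))

infixl 6 _+ᴿ_ _-ᴿ_
infixl 7 _*ᴿ_
infix  4 _<ᴿ_ _⟶_

fromℚ : ℚ → ℝ
fromℚ q = mkℝ (λ _ → q) (cauchy-const q)

_+ᴿ_ : ℝ → ℝ → ℝ
x +ᴿ y = mkℝ (λ n → seq x n ℚ.+ seq y n)
  (cauchy-+ {seq x} {seq y} (cauchy x) (cauchy y))

_*ᴿ_ : ℝ → ℝ → ℝ
x *ᴿ y = mkℝ (λ n → seq x n ℚ.* seq y n)
  (cauchy-* {seq x} {seq y} (cauchy x) (cauchy y))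

_-ᴿ_ : ℝ → ℝ → ℝ
x -ᴿ y = mkℝ (λ n → seq x n ℚ.- seq y n)
  (cauchy-+ {seq x} {λ n → ℚ.- seq y n} (cauchy x) (cauchy-neg {seq y} (cauchy y)))

∣_∣ᴿ : ℝ → ℝ
∣ x ∣ᴿ = mkℝ (λ n → ℚ.∣ seq x n ∣) (cauchy-abs {seq x} (cauchy x))

-- The gap δ, uniform in n, is what makes the inequality of limits strict.
_<ᴿ_ : ℝ → ℝ → Set
x <ᴿ y = Σ[ δ ∈ ℚ ] 0ℚ ℚ.< δ ×
  (∃[ N ] (∀ n → N ℕ.≤ n → seq x n ℚ.+ δ ℚ.≤ seq y n))

_⟶_ : (ℕ → ℝ) → ℝ → Set
s ⟶ x = ∀ ε → 0ℚ ℚ.< ε →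
  ∃[ N ] (∀ n → N ℕ.≤ n → ∣ s n -ᴿ x ∣ᴿ <ᴿ fromℚ ε)

private
  <½⇒+½≤ : ∀ p ε → p ℚ.< ε ℚ.* ½ → p ℚ.+ ε ℚ.* ½ ℚ.≤ ε
  <½⇒+½≤ p ε p<½ε = subst (p ℚ.+ ε ℚ.* ½ ℚ.≤_) (half+half ε)
    (ℚₚ.+-monoˡ-≤ (ε ℚ.* ½) (ℚₚ.<⇒≤ p<½ε))

seq⟶ : ∀ x → (λ N → fromℚ (seq x N)) ⟶ x
seq⟶ x ε 0<ε with cauchy x (ε ℚ.* ½) (half-pos 0<ε)
... | N , h = N , λ n N≤n → ε ℚ.* ½ , half-pos 0<ε , N , λ m N≤m →
  <½⇒+½≤ (ℚ.∣ seq x n ℚ.- seq x m ∣) ε (h n m N≤n N≤m)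

∑₁ : ((n : ℕ) → .{{NonZero n}} → ℚ) → ℕ → ℚ
∑₁ f zero    = 0ℚ
∑₁ f (suc n) = ∑₁ f n ℚ.+ f (suc n)

∑₀ᴿ : (ℕ → ℝ) → ℕ → ℝ
∑₀ᴿ f zero    = f zero
∑₀ᴿ f (suc n) = ∑₀ᴿ f n +ᴿ f (suc n)

HasSum : ((n : ℕ) → .{{NonZero n}} → ℚ) → ℝ → Set
HasSum f x = (λ N → fromℚ (∑₁ f N)) ⟶ x

recip^ : (n s : ℕ) → .{{NonZero n}} → ℚ
recip^ n s = ℚ._/_ (+ 1) (n ℕ.^ s) {{ℕₚ.m^n≢0 n s}}

-- ζ⋆ n j is ζₙ⋆({2}ⱼ), written as an iterated sum: m is the outermost
-- (largest) variable n₁ ≤ n, and the remaining variables satisfy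
-- n₁ ≥ n₂ ≥ ⋯ ≥ nⱼ ≥ 1.
ζ⋆ : ℕ → ℕ → ℚ
ζ⋆ n zero    = 1ℚ
ζ⋆ n (suc j) = ∑₁ (λ m → recip^ m 2 ℚ.* ζ⋆ m j) n

centralWeight : (n : ℕ) → .{{NonZero n}} → ℚ
centralWeight n =
  ℚ._/_ (+ ((2 ℕ.* n) C n)) (n ℕ.^ 2 ℕ.* 4 ℕ.^ n)
    {{ℕₚ.m*n≢0 (n ℕ.^ 2) (4 ℕ.^ n) {{ℕₚ.m^n≢0 n 2}} {{ℕₚ.m^n≢0 4 n}}}}

-1^ : ℕ → ℚ
-1^ n = (ℚ.- 1ℚ) ^ℚ n

ηTerm : ℕ → (n : ℕ) → .{{NonZero n}} → ℚ
ηTerm s n = -1^ (n ℕ.∸ 1) ℚ.* recip^ n s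

private
  fromℚᵘ-mono-≤ : ∀ {p q} → p ℚᵘ.≤ q → fromℚᵘ p ℚ.≤ fromℚᵘ q
  fromℚᵘ-mono-≤ {p} {q} p≤q = ℚₚ.toℚᵘ-cancel-≤
    (ℚᵘₚ.≤-respˡ-≃ (ℚᵘₚ.≃-sym (ℚₚ.toℚᵘ-fromℚᵘ p))
      (ℚᵘₚ.≤-respʳ-≃ (ℚᵘₚ.≃-sym (ℚₚ.toℚᵘ-fromℚᵘ q)) p≤q))

  1/-antimono : ∀ a b .{{_ : NonZero a}} .{{_ : NonZero b}} →
    a ℕ.≤ b → (+ 1) ℚ./ b ℚ.≤ (+ 1) ℚ./ a
  1/-antimono (suc a) (suc b) a≤b =
    fromℚᵘ-mono-≤ {ℚᵘ.mkℚᵘ (+ 1) b} {ℚᵘ.mkℚᵘ (+ 1) a}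
      (ℚᵘ.*≤* (ℤₚ.*-monoˡ-≤-nonNeg (+ 1) (ℤ.+≤+ a≤b)))

  0≤recip^ : ∀ n s .{{_ : NonZero n}} → 0ℚ ℚ.≤ recip^ n s
  0≤recip^ n s = ℚₚ.nonNegative⁻¹ (recip^ n s)
    {{ℚₚ.normalize-nonNeg 1 (n ℕ.^ s) {{ℕₚ.m^n≢0 n s}}}}

  recip^-antimono : ∀ m s → recip^ (suc (suc m)) s ℚ.≤ recip^ (suc m) s
  recip^-antimono m s = 1/-antimono (suc m ℕ.^ s) (suc (suc m) ℕ.^ s)
    {{ℕₚ.m^n≢0 (suc m) s}} {{ℕₚ.m^n≢0 (suc (suc m)) s}}
    (ℕₚ.^-monoˡ-≤ s (ℕₚ.n≤1+n (suc m)))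

  archimedean : ∀ ε → 0ℚ ℚ.< ε → ∃[ N ] (∀ m → N ℕ.≤ m → (+ 1) ℚ./ suc m ℚ.< ε)
  archimedean (mkℚ (+ 0)    _ _) (ℚ.*<* (ℤ.+<+ ()))
  archimedean (mkℚ -[1+ _ ] _ _) (ℚ.*<* ())
  archimedean (mkℚ +[1+ p ] d _) _ = suc d , λ m d<m → ℚₚ.toℚᵘ-cancel-<
    (ℚᵘₚ.<-respˡ-≃ (ℚᵘₚ.≃-sym (ℚₚ.toℚᵘ-fromℚᵘ (ℚᵘ.mkℚᵘ (+ 1) m)))
      (ℚᵘ.*<* (ℤ.+<+ (ℕₚ.<-≤-trans
        (subst (ℕ._< suc m) (sym (ℕₚ.*-identityˡ (suc d))) (s≤s d<m))
        (ℕₚ.m≤n*m (suc m) (suc p))))))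

  recip^-small : ∀ s ε → 0ℚ ℚ.< ε →
    ∃[ N ] (∀ m → N ℕ.≤ m → recip^ (suc m) (suc s) ℚ.< ε)
  recip^-small s ε 0<ε with archimedean ε 0<ε
  ... | N , h = N , λ m N≤m → ℚₚ.≤-<-trans
    (1/-antimono (suc m) (suc m ℕ.^ suc s) {{_}} {{ℕₚ.m^n≢0 (suc m) (suc s)}}
      (ℕₚ.m≤m*n (suc m) (suc m ℕ.^ s) {{ℕₚ.m^n≢0 (suc m) s}}))
    (h m N≤m)

  -- 1/(m+1)ˢ - 1/(m+2)ˢ + ⋯, with k terms
  tail : ℕ → ℕ → ℕ → ℚ
  tail s m zero    = 0ℚ
  tail s m (suc k) = recip^ (suc m) s ℚ.- tail s (suc m) k

  tail-bounds : ∀ s m k → 0ℚ ℚ.≤ tail s m k × tail s m k ℚ.≤ recip^ (suc m) s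
  tail-bounds s m zero    = ℚₚ.≤-refl , 0≤recip^ (suc m) s
  tail-bounds s m (suc k) with tail-bounds s (suc m) k
  ... | 0≤t , t≤r = 0≤q-p (ℚₚ.≤-trans t≤r (recip^-antimono m s)) , q-p≤q 0≤t

  -1^-suc : ∀ n → -1^ (suc n) ≡ ℚ.- -1^ n
  -1^-suc n = trans (sym (ℚₚ.neg-distribˡ-* 1ℚ (-1^ n)))
    (cong ℚ.-_ (ℚₚ.*-identityˡ (-1^ n)))

  ∑₁-tail : ∀ s m k →
    ∑₁ (ηTerm s) (k ℕ.+ m) ℚ.- ∑₁ (ηTerm s) m ≡ -1^ m ℚ.* tail s m k
  ∑₁-tail s m zero = trans (ℚₚ.+-inverseʳ (∑₁ (ηTerm s) m)) (sym (ℚₚ.*-zeroʳ (-1^ m)))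
  ∑₁-tail s m (suc k) = trans
    (cong (λ i → ∑₁ (ηTerm s) i ℚ.- ∑₁ (ηTerm s) m) (sym (ℕₚ.+-suc k m)))
    (trans
      (tail-step
        (∑₁ (ηTerm s) (k ℕ.+ suc m)) (∑₁ (ηTerm s) m) (-1^ m) (recip^ (suc m) s))
      (trans
        (cong (ℚ._+ -1^ m ℚ.* recip^ (suc m) s)
          (trans (∑₁-tail s (suc m) k)
            (cong (ℚ._* tail s (suc m) k) (-1^-suc m))))
        (alternate (-1^ m) (tail s (suc m) k) (recip^ (suc m) s))))

  ∣-1^∣ : ∀ n → ℚ.∣ -1^ n ∣ ≡ 1ℚ
  ∣-1^∣ zero    = refl
  ∣-1^∣ (suc n) = trans (ℚₚ.∣p*q∣≡∣p∣*∣q∣ (ℚ.- 1ℚ) (-1^ n))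
    (trans (ℚₚ.*-identityˡ _) (∣-1^∣ n))

  ∑₁-diff : ∀ s m n → m ℕ.≤ n →
    ℚ.∣ ∑₁ (ηTerm s) n ℚ.- ∑₁ (ηTerm s) m ∣ ℚ.≤ recip^ (suc m) s
  ∑₁-diff s m n m≤n with ℕₚ.m≤n⇒∃[o]m+o≡n m≤n
  ... | k , refl = subst (ℚ._≤ recip^ (suc m) s) (sym eq) (proj₂ (tail-bounds s m k))
    where
    eq : ℚ.∣ ∑₁ (ηTerm s) (m ℕ.+ k) ℚ.- ∑₁ (ηTerm s) m ∣ ≡ tail s m k
    eq = trans
      (cong (λ i → ℚ.∣ ∑₁ (ηTerm s) i ℚ.- ∑₁ (ηTerm s) m ∣) (ℕₚ.+-comm m k))
      (trans (cong ℚ.∣_∣ (∑₁-tail s m k))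
        (trans (ℚₚ.∣p*q∣≡∣p∣*∣q∣ (-1^ m) (tail s m k))
          (trans (cong₂ ℚ._*_ (∣-1^∣ m) (ℚₚ.0≤p⇒∣p∣≡p (proj₁ (tail-bounds s m k))))
            (ℚₚ.*-identityˡ _))))

  cauchy-η : ∀ s → Cauchy (∑₁ (ηTerm (suc s)))
  cauchy-η s ε 0<ε with recip^-small s ε 0<ε
  ... | N , small = N , go
    where
    S = ∑₁ (ηTerm (suc s))
    go : ∀ m n → N ℕ.≤ m → N ℕ.≤ n → ℚ.∣ S m ℚ.- S n ∣ ℚ.< ε
    go m n N≤m N≤n with ℕₚ.≤-total m n
    ... | inj₁ m≤n = subst (ℚ._< ε) (∣-∣-swap (S n) (S m))
                       (ℚₚ.≤-<-trans (∑₁-diff (suc s) m n m≤n) (small m N≤m))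
    ... | inj₂ n≤m = ℚₚ.≤-<-trans (∑₁-diff (suc s) n m n≤m) (small n N≤n)

-- The Dirichlet eta function at nonnegative integers.  For s ≥ 1 the
-- Cauchy sequence of partial sums of Σ (-1)ⁿ⁻¹/nˢ represents its sum, as
-- η-hasSum confirms; at 0, where the series diverges, η(0) = ½ by
-- convention.
η : ℕ → ℝ
η zero    = fromℚ ½
η (suc s) = mkℝ (∑₁ (ηTerm (suc s))) (cauchy-η s)

η-hasSum : ∀ s → HasSum (ηTerm (suc s)) (η (suc s))
η-hasSum s = seq⟶ (η (suc s))

{-# OPTIONS --safe #-}

-- Write s_k = (-1)^(k-1).  Two finite partial fraction expansions reduce both
-- sides to the same shape.  On the left,
--   ζₙ⋆({2}ⱼ) = 2 Σ_{k≤n} s_k k^(-2j) n!²/((n-k)!(n+k)!),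
-- so the M-th partial sum is 2 Σ_{k≤M} s_k k^(-2j-1) V_k with
--   V_k = k Σ_{n≤M} C(2n,n+k) / (4ⁿ n²).
-- On the right, truncating each η at M and summing the geometric progressions
-- gives the same expression with V_k replaced by 1/k - 2 Σ_{l≤M} s_l/(l+k).
-- Consecutive V_k add up to 1/k - 1/(k+1) up to the probability that a random
-- walk fails to reach k in M steps, which is O(M^(-1/2)); so do the replacements,
-- up to O(1/M).  Hence the differences D_k almost cancel in consecutive pairs,
-- and since |D_k| ≤ 2/k, they tend to 0 in the weighted sum.
-- Indices are shifted throughout: i stands for k = i + 1, and r i = 1/(i + 1).
module Submission where

open import Data.Nat as ℕ using (ℕ; zero; suc; NonZero; _!)
import Data.Nat.Properties as ℕₚ
open import Data.Nat.Combinatorics using (_C_; nCk≡n!/k![n-k]!; k![n∸k]!∣n!)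
open import Data.Nat.DivMod using (m/n*n≡m)
open import Data.Integer as ℤ using (+[1+_]; -[1+_])
import Data.Integer.Properties as ℤₚ
open import Data.Rational as ℚ using (ℚ; mkℚ; 0ℚ; 1ℚ; ½)
import Data.Rational.Properties as ℚₚ
import Data.Rational.Unnormalised as ℚᵘ
import Data.Rational.Unnormalised.Properties as ℚᵘₚ
open import Data.Rational.Solver using (module +-*-Solver)
open import Data.Product using (∃-syntax; _×_; _,_; proj₁; proj₂)
open import Data.Sum using (inj₁; inj₂)
open import Relation.Binary.PropositionalEquality
open import Relation.Nullary using (yes; no; contradiction)
open import Defs

module _ where
  open import Data.Rational using (_+_; _*_; _-_; -_; _≤_; _<_; ∣_∣)
  open +-*-Solver using (solve; _:+_; _:*_; _:-_; :-_; _:=_; con)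

  -- Arithmetic and order in ℚ, and proofs of equations by clearing denominators.

  2ℚ : ℚ
  2ℚ = (ℤ.+ 2) ℚ./ 1

  0≤* : ∀ {p q} → 0ℚ ≤ p → 0ℚ ≤ q → 0ℚ ≤ p * q
  0≤* {p} {q} 0≤p 0≤q = subst (_≤ p * q) (ℚₚ.*-zeroˡ q)
    (ℚₚ.*-monoʳ-≤-nonNeg q {{ℚ.nonNegative 0≤q}} 0≤p)

  0≤+ : ∀ {p q} → 0ℚ ≤ p → 0ℚ ≤ q → 0ℚ ≤ p + q
  0≤+ {p} {q} 0≤p 0≤q = subst (_≤ p + q) (ℚₚ.+-identityˡ 0ℚ) (ℚₚ.+-mono-≤ 0≤p 0≤q)

  p≤p+q : ∀ {p q} → 0ℚ ≤ q → p ≤ p + q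
  p≤p+q {p} {q} 0≤q = subst (_≤ p + q) (ℚₚ.+-identityʳ p) (ℚₚ.+-monoʳ-≤ p 0≤q)

  p≤q⇒0≤q-p : ∀ {p q} → p ≤ q → 0ℚ ≤ q - p
  p≤q⇒0≤q-p {p} {q} p≤q =
    subst (_≤ q - p) (ℚₚ.+-inverseʳ p) (ℚₚ.+-monoˡ-≤ (- p) p≤q)

  p-q≡0⇒p≡q : ∀ {p q} → p - q ≡ 0ℚ → p ≡ q
  p-q≡0⇒p≡q {p} {q} h = trans
    (solve 2 (λ p q → p := (p :- q) :+ q) refl p q)
    (trans (cong (_+ q) h) (ℚₚ.+-identityˡ q))

  p≡q⇒p-q≡0 : ∀ {p q} → p ≡ q → p - q ≡ 0ℚ
  p≡q⇒p-q≡0 {p} refl = ℚₚ.+-inverseʳ p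

  -- The level lies between multiplication at 7 and addition at 6, so a product serves as
  -- coefficient without parentheses. `_⊞_` nests to the right, and the ring identities below are
  -- bracketed to match.
  infix 6.5 _·_
  infixr 6 _⊞_

  _·_ : ∀ {a b} c → a ≡ b → c * (a - b) ≡ 0ℚ
  c · h = trans (cong (c *_) (p≡q⇒p-q≡0 h)) (ℚₚ.*-zeroʳ c)

  _⊞_ : ∀ {a b} → a ≡ 0ℚ → b ≡ 0ℚ → a + b ≡ 0ℚ
  refl ⊞ refl = refl

  -- Denominators are cleared by writing p - q as an explicit combination of
  -- differences known to vanish, which leaves a polynomial identity.
  combination : ∀ {p q t} → t ≡ 0ℚ → p - q ≡ t → p ≡ q
  combination t≡0 e = p-q≡0⇒p≡q (trans e t≡0)

  ≤-by-difference : ∀ {p q} d → 0ℚ ≤ d → q ≡ p + d → p ≤ q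
  ≤-by-difference {p} d 0≤d e = subst (p ≤_) (sym e) (p≤p+q 0≤d)

  ∣p∣≤q : ∀ {p q} → p ≤ q → - p ≤ q → ∣ p ∣ ≤ q
  ∣p∣≤q {p} {q} p≤q -p≤q with ℚₚ.∣p∣≡p∨∣p∣≡-p p
  ... | inj₁ e = subst (_≤ q) (sym e) p≤q
  ... | inj₂ e = subst (_≤ q) (sym e) -p≤q

  -- Naturals and their reciprocals as rationals.

  ι : ℕ → ℚ
  ι zero    = 0ℚ
  -- With this recursion in place of n / 1, successors unfold inside ring identities.
  ι (suc n) = ι n + 1ℚ

  0≤ι : ∀ n → 0ℚ ≤ ι n
  0≤ι zero    = ℚₚ.≤-refl
  0≤ι (suc n) = 0≤+ (0≤ι n) (ℚₚ.<⇒≤ (ℚₚ.positive⁻¹ 1ℚ))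

  ι-homo-+ : ∀ m n → ι (m ℕ.+ n) ≡ ι m + ι n
  ι-homo-+ zero    n = sym (ℚₚ.+-identityˡ (ι n))
  ι-homo-+ (suc m) n = trans (cong (_+ 1ℚ) (ι-homo-+ m n))
    (solve 2 (λ x y → x :+ y :+ con 1ℚ := x :+ con 1ℚ :+ y) refl (ι m) (ι n))

  ι-homo-* : ∀ m n → ι (m ℕ.* n) ≡ ι m * ι n
  ι-homo-* zero    n = sym (ℚₚ.*-zeroˡ (ι n))
  ι-homo-* (suc m) n = trans (ι-homo-+ n (m ℕ.* n))
    (trans (cong (ι n +_) (ι-homo-* m n))
      (solve 2 (λ x y → y :+ x :* y := (x :+ con 1ℚ) :* y) refl (ι m) (ι n)))

  ι-homo-^ : ∀ m n → ι (m ℕ.^ n) ≡ ι m ^ℚ n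
  ι-homo-^ m zero    = refl
  ι-homo-^ m (suc n) = trans (ι-homo-* m (m ℕ.^ n)) (cong (ι m *_) (ι-homo-^ m n))

  ι-mono-≤ : ∀ {m n} → m ℕ.≤ n → ι m ≤ ι n
  ι-mono-≤ {m} m≤n with ℕₚ.m≤n⇒∃[o]m+o≡n m≤n
  ... | k , refl = ≤-by-difference (ι k) (0≤ι k) (ι-homo-+ m k)

  +n/1≡ι : ∀ n → (ℤ.+ n) ℚ./ 1 ≡ ι n
  +n/1≡ι zero    = refl
  +n/1≡ι (suc n) = trans (ℚₚ.fromℚᵘ-cong (suc≃ n)) (trans (ℚₚ.toℚᵘ-injective
      (ℚᵘₚ.≃-trans (ℚₚ.toℚᵘ-fromℚᵘ (nᵘ ℚᵘ.+ 1ᵘ))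
        (ℚᵘₚ.≃-trans (ℚᵘₚ.+-cong (ℚᵘₚ.≃-sym (ℚₚ.toℚᵘ-fromℚᵘ nᵘ)) (ℚᵘₚ.≃-refl {1ᵘ}))
          (ℚᵘₚ.≃-sym (ℚₚ.toℚᵘ-homo-+ ((ℤ.+ n) ℚ./ 1) 1ℚ)))))
    (cong (_+ 1ℚ) (+n/1≡ι n)))
    where
    nᵘ = ℚᵘ.mkℚᵘ (ℤ.+ n) 0
    1ᵘ = ℚᵘ.mkℚᵘ (ℤ.+ 1) 0
    suc≃ : ∀ n → ℚᵘ.mkℚᵘ (ℤ.+ suc n) 0 ℚᵘ.≃ ℚᵘ.mkℚᵘ (ℤ.+ n) 0 ℚᵘ.+ 1ᵘ
    suc≃ n = ℚᵘ.*≡* (cong (ℤ._* (ℤ.+ 1)) (trans (cong ℤ.+_ (ℕₚ.+-comm 1 n))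
      (cong (ℤ._+ (ℤ.+ 1)) (sym (ℤₚ.*-identityʳ (ℤ.+ n))))))

  -- Together with `*-ι-cancel` this replaces computation with normalised fractions: rationals are
  -- compared after multiplication by a denominator.
  a/b*ιb≡ιa : ∀ a b .{{_ : NonZero b}} → (ℤ.+ a) ℚ./ b * ι b ≡ ι a
  a/b*ιb≡ιa a b@(suc b-1) = trans (cong ((ℤ.+ a) ℚ./ b *_) (sym (+n/1≡ι b)))
    (trans (ℚₚ.toℚᵘ-injective
      (ℚᵘₚ.≃-trans (ℚₚ.toℚᵘ-homo-* ((ℤ.+ a) ℚ./ b) ((ℤ.+ b) ℚ./ 1))
        (ℚᵘₚ.≃-trans (ℚᵘₚ.*-cong (ℚₚ.toℚᵘ-fromℚᵘ a/bᵘ) (ℚₚ.toℚᵘ-fromℚᵘ bᵘ))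
          (ℚᵘₚ.≃-trans a/b*b≃a (ℚᵘₚ.≃-sym (ℚₚ.toℚᵘ-fromℚᵘ aᵘ))))))
    (+n/1≡ι a))
    where
    a/bᵘ = ℚᵘ.mkℚᵘ (ℤ.+ a) b-1
    aᵘ = ℚᵘ.mkℚᵘ (ℤ.+ a) 0
    bᵘ = ℚᵘ.mkℚᵘ (ℤ.+ b) 0
    a/b*b≃a : a/bᵘ ℚᵘ.* bᵘ ℚᵘ.≃ aᵘ
    a/b*b≃a = ℚᵘ.*≡* (trans (ℤₚ.*-identityʳ ((ℤ.+ a) ℤ.* (ℤ.+ b)))
      (cong (λ k → (ℤ.+ a) ℤ.* (ℤ.+ k)) (sym (ℕₚ.*-identityʳ b))))

  -- Outside this block `r` is an atom known only through `r-inverse` and `0<r`; it does not unfold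
  -- to a normalised fraction.
  abstract
    r : ℕ → ℚ
    r n = (ℤ.+ 1) ℚ./ suc n

    r-inverse : ∀ n → r n * (ι n + 1ℚ) ≡ 1ℚ
    r-inverse n = a/b*ιb≡ιa 1 (suc n)

    0<r : ∀ n → 0ℚ < r n
    0<r n = ℚₚ.positive⁻¹ (r n) {{ℚₚ.normalize-pos 1 (suc n)}}

  0≤r : ∀ n → 0ℚ ≤ r n
  0≤r n = ℚₚ.<⇒≤ (0<r n)

  *-ι-cancel : ∀ {p q} n .{{_ : NonZero n}} → p * ι n ≡ q * ι n → p ≡ q
  *-ι-cancel {p} {q} (suc n) h = combination ((p - q) · sym (r-inverse n) ⊞ r n · h)
    (solve 4 (λ p q x r → p :- q :=
        (p :- q) :* (con 1ℚ :- r :* (x :+ con 1ℚ))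
        :+ r :* (p :* (x :+ con 1ℚ) :- q :* (x :+ con 1ℚ)))
      refl p q (ι n) (r n))

  ^-distrib-* : ∀ p q n → (p * q) ^ℚ n ≡ p ^ℚ n * q ^ℚ n
  ^-distrib-* p q zero    = refl
  ^-distrib-* p q (suc n) = trans (cong (p * q *_) (^-distrib-* p q n))
    (solve 4 (λ p q x y → p :* q :* (x :* y) := p :* x :* (q :* y)) refl
      p q (p ^ℚ n) (q ^ℚ n))

  1^n≡1 : ∀ n → 1ℚ ^ℚ n ≡ 1ℚ
  1^n≡1 zero    = refl
  1^n≡1 (suc n) = trans (ℚₚ.*-identityˡ (1ℚ ^ℚ n)) (1^n≡1 n)

  recip^≡r^ : ∀ n s → recip^ (suc n) s ≡ r n ^ℚ s
  recip^≡r^ n s = *-ι-cancel (suc n ℕ.^ s) {{ℕₚ.m^n≢0 (suc n) s}} (trans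
    (a/b*ιb≡ιa 1 (suc n ℕ.^ s) {{ℕₚ.m^n≢0 (suc n) s}})
    (sym (trans (cong (r n ^ℚ s *_) (ι-homo-^ (suc n) s))
      (trans (sym (^-distrib-* (r n) (ι (suc n)) s))
        (trans (cong (_^ℚ s) (r-inverse n)) (1^n≡1 s))))))

  r*ι≤1 : ∀ {m n} → m ℕ.≤ suc n → r n * ι m ≤ 1ℚ
  r*ι≤1 {m} {n} m≤1+n = subst (r n * ι m ≤_) (r-inverse n)
    (ℚₚ.*-monoˡ-≤-nonNeg (r n) {{ℚ.nonNegative (0≤r n)}} (ι-mono-≤ m≤1+n))

  r-antimono : ∀ {m n} → m ℕ.≤ n → r n ≤ r m
  r-antimono {m} {n} m≤n = ≤-by-difference (r m * (1ℚ - r n * ι (suc m)))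
    (0≤* (0≤r m) (p≤q⇒0≤q-p (r*ι≤1 (ℕ.s≤s m≤n))))
    (combination (r n · r-inverse m)
      (solve 3 (λ x rm rn → rm :- (rn :+ rm :* (con 1ℚ :- rn :* (x :+ con 1ℚ)))
          := rn :* (rm :* (x :+ con 1ℚ) :- con 1ℚ))
        refl (ι m) (r m) (r n)))

  r≤1 : ∀ n → r n ≤ 1ℚ
  r≤1 n = subst (_≤ 1ℚ) (trans (cong (r n *_) (ℚₚ.+-identityˡ 1ℚ)) (ℚₚ.*-identityʳ (r n)))
    (r*ι≤1 {1} (ℕ.s≤s ℕ.z≤n))

  -- Finite sums.

  ∑< : ℕ → (ℕ → ℚ) → ℚ
  ∑< zero    f = 0ℚ
  ∑< (suc n) f = ∑< n f + f n

  infix 5 ∑<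
  syntax ∑< n (λ i → t) = ∑[ i < n ] t

  ∑-cong-< : ∀ n {f g} → (∀ i → i ℕ.< n → f i ≡ g i) → ∑< n f ≡ ∑< n g
  ∑-cong-< zero    h = refl
  ∑-cong-< (suc n) h =
    cong₂ _+_ (∑-cong-< n (λ i i<n → h i (ℕₚ.m<n⇒m<1+n i<n))) (h n ℕₚ.≤-refl)

  ∑-cong : ∀ n {f g} → (∀ i → f i ≡ g i) → ∑< n f ≡ ∑< n g
  ∑-cong n h = ∑-cong-< n (λ i _ → h i)

  ∑-zero : ∀ n → ∑< n (λ _ → 0ℚ) ≡ 0ℚ
  ∑-zero zero    = refl
  ∑-zero (suc n) = trans (ℚₚ.+-identityʳ _) (∑-zero n)

  ∑-distrib-+ : ∀ n f g → (∑[ i < n ] f i + g i) ≡ ∑< n f + ∑< n g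
  ∑-distrib-+ zero    f g = refl
  ∑-distrib-+ (suc n) f g = trans (cong (_+ (f n + g n)) (∑-distrib-+ n f g))
    (solve 4 (λ a b x y → a :+ b :+ (x :+ y) := a :+ x :+ (b :+ y)) refl
      (∑< n f) (∑< n g) (f n) (g n))

  *-distrib-∑ : ∀ n p f → p * ∑< n f ≡ (∑[ i < n ] p * f i)
  *-distrib-∑ zero    p f = ℚₚ.*-zeroʳ p
  *-distrib-∑ (suc n) p f =
    trans (ℚₚ.*-distribˡ-+ p (∑< n f) (f n)) (cong (_+ p * f n) (*-distrib-∑ n p f))

  ∑-distrib-- : ∀ n f g → (∑[ i < n ] f i - g i) ≡ ∑< n f - ∑< n g
  ∑-distrib-- zero    f g = refl
  ∑-distrib-- (suc n) f g = trans (cong (_+ (f n - g n)) (∑-distrib-- n f g))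
    (solve 4 (λ a b x y → (a :- b) :+ (x :- y) := (a :+ x) :- (b :+ y)) refl
      (∑< n f) (∑< n g) (f n) (g n))

  ∑-swap : ∀ m n (f : ℕ → ℕ → ℚ) →
    (∑[ i < m ] ∑[ k < n ] f i k) ≡ (∑[ k < n ] ∑[ i < m ] f i k)
  ∑-swap zero    n f = sym (∑-zero n)
  ∑-swap (suc m) n f = trans (cong (_+ ∑< n (f m)) (∑-swap m n f))
    (sym (∑-distrib-+ n (λ k → ∑[ i < m ] f i k) (f m)))

  ∑-head : ∀ n f → ∑< (suc n) f ≡ f 0 + (∑[ i < n ] f (suc i))
  ∑-head zero    f = ℚₚ.+-comm 0ℚ (f 0)
  ∑-head (suc n) f = trans (cong (_+ f (suc n)) (∑-head n f)) (ℚₚ.+-assoc (f 0) _ _)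

  ∑-nonNeg : ∀ n {f} → (∀ i → 0ℚ ≤ f i) → 0ℚ ≤ ∑< n f
  ∑-nonNeg zero    h = ℚₚ.≤-refl
  ∑-nonNeg (suc n) h = 0≤+ (∑-nonNeg n h) (h n)

  ∑₁≡∑ : ∀ (f : (n : ℕ) → .{{NonZero n}} → ℚ) n → ∑₁ f n ≡ (∑[ i < n ] f (suc i))
  ∑₁≡∑ f zero    = refl
  ∑₁≡∑ f (suc n) = cong (_+ f (suc n)) (∑₁≡∑ f n)

  -- The central binomial probability C(2n,n)/4ⁿ.

  a : ℕ → ℚ
  a zero    = 1ℚ
  -- The factor is (2n+1)/(2n+2), the ratio of consecutive values of C(2n,n)/4ⁿ.
  a (suc n) = a n * (1ℚ - r n * ½)

  -- Identifies `a` with denominators cleared, so that the induction only needs (2n+2)! =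
  -- (2n+2)(2n+1)(2n)!.
  a*4^n*n!²≡[2n]! : ∀ n → a n * ι (4 ℕ.^ n) * (ι (n !) * ι (n !)) ≡ ι ((2 ℕ.* n) !)
  a*4^n*n!²≡[2n]! zero    = refl
  a*4^n*n!²≡[2n]! (suc n) = begin
    a (suc n) * ι (4 ℕ.* 4 ℕ.^ n) * (ι (suc n ℕ.* n !) * ι (suc n ℕ.* n !))
      ≡⟨ cong₂ (λ x y → a (suc n) * x * (y * y))
           (ι-homo-* 4 (4 ℕ.^ n)) (ι-homo-* (suc n) (n !)) ⟩
    a n * (1ℚ - r n * ½) * (ι 4 * u) * (x+1 * v * (x+1 * v))
      ≡⟨ combination
           (- (2ℚ * (x + 1ℚ) * (a n * u * (v * v))) · r-inverse n)
           (solve 5 (λ a ρ u v x →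
               a :* (con 1ℚ :- ρ :* con ½) :* (con (ι 4) :* u)
                 :* ((x :+ con 1ℚ) :* v :* ((x :+ con 1ℚ) :* v))
               :- (con 2ℚ :* x :+ con 1ℚ :+ con 1ℚ) :* ((con 2ℚ :* x :+ con 1ℚ)
                 :* (a :* u :* (v :* v)))
               := (:- (con 2ℚ :* (x :+ con 1ℚ) :* (a :* u :* (v :* v))))
                 :* (ρ :* (x :+ con 1ℚ) :- con 1ℚ))
             refl (a n) (r n) u v x) ⟩
    (2ℚ * x + 1ℚ + 1ℚ) * ((2ℚ * x + 1ℚ) * (a n * u * (v * v)))
      ≡⟨ cong₂ (λ y z → (y + 1ℚ + 1ℚ) * ((y + 1ℚ) * z))
           (sym (ι-homo-* 2 n)) (a*4^n*n!²≡[2n]! n) ⟩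
    (ι 2n + 1ℚ + 1ℚ) * ((ι 2n + 1ℚ) * ι (2n !))
      ≡⟨ cong (ι (suc (suc 2n)) *_) (sym (ι-homo-* (suc 2n) (2n !))) ⟩
    ι (suc (suc 2n)) * ι ((suc 2n) !)
      ≡⟨ sym (ι-homo-* (suc (suc 2n)) ((suc 2n) !)) ⟩
    ι ((suc (suc 2n)) !)
      ≡⟨ cong (λ k → ι (suc k !)) (sym (ℕₚ.+-suc n (n ℕ.+ 0))) ⟩
    ι ((2 ℕ.* suc n) !) ∎
    where
    open ≡-Reasoning
    u = ι (4 ℕ.^ n)
    v = ι (n !)
    x = ι n
    x+1 = ι (suc n)
    2n = 2 ℕ.* n

  central-binomial : ∀ n → ι ((2 ℕ.* n) C n) ≡ a n * ι (4 ℕ.^ n)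
  central-binomial n = *-ι-cancel (n ! ℕ.* n !) {{n!*n!≢0}} (begin
    ι ((2 ℕ.* n) C n) * ι (n ! ℕ.* n !)  ≡⟨ sym (ι-homo-* ((2 ℕ.* n) C n) (n ! ℕ.* n !)) ⟩
    ι (((2 ℕ.* n) C n) ℕ.* (n ! ℕ.* n !))  ≡⟨ cong ι C*n!² ⟩
    ι ((2 ℕ.* n) !)                      ≡⟨ sym (a*4^n*n!²≡[2n]! n) ⟩
    a n * ι (4 ℕ.^ n) * (ι (n !) * ι (n !))
      ≡⟨ cong (a n * ι (4 ℕ.^ n) *_) (sym (ι-homo-* (n !) (n !))) ⟩
    a n * ι (4 ℕ.^ n) * ι (n ! ℕ.* n !)  ∎)
    where
    open ≡-Reasoning
    n!*n!≢0 : NonZero (n ! ℕ.* n !)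
    n!*n!≢0 = ℕₚ.m*n≢0 (n !) (n !) {{n ℕₚ.!≢0}} {{n ℕₚ.!≢0}}
    n≤2n : n ℕ.≤ 2 ℕ.* n
    n≤2n = ℕₚ.m≤m+n n (n ℕ.+ 0)
    2n∸n≡n : 2 ℕ.* n ℕ.∸ n ≡ n
    2n∸n≡n = trans (ℕₚ.m+n∸m≡n n (n ℕ.+ 0)) (ℕₚ.+-identityʳ n)
    C*n!² : ((2 ℕ.* n) C n) ℕ.* (n ! ℕ.* n !) ≡ (2 ℕ.* n) !
    C*n!² = trans
      (cong (λ k → ((2 ℕ.* n) C n) ℕ.* (n ! ℕ.* k !)) (sym 2n∸n≡n))
      (trans (cong (λ k → k ℕ.* (n ! ℕ.* (2 ℕ.* n ℕ.∸ n) !)) (nCk≡n!/k![n-k]! n≤2n))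
        (m/n*n≡m {{n ℕₚ.!* (2 ℕ.* n ℕ.∸ n) !≢0}} (k![n∸k]!∣n! n≤2n)))

  centralWeight≡ : ∀ n → centralWeight (suc n) ≡ r n * r n * a (suc n)
  centralWeight≡ n = *-ι-cancel d {{d≢0}} (begin
    centralWeight (suc n) * ι d
      ≡⟨ a/b*ιb≡ιa ((2 ℕ.* suc n) C suc n) d {{d≢0}} ⟩
    ι ((2 ℕ.* suc n) C suc n)
      ≡⟨ central-binomial (suc n) ⟩
    a (suc n) * u
      ≡⟨ combination (a (suc n) * u * - (ι (suc n) * r n + 1ℚ) · r-inverse n)
           (solve 4 (λ a u x ρ →
               a :* u :- ρ :* ρ :* a :* ((x :+ con 1ℚ) :* ((x :+ con 1ℚ) :* con 1ℚ) :* u)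
               := a :* u :* (:- ((x :+ con 1ℚ) :* ρ :+ con 1ℚ))
                 :* (ρ :* (x :+ con 1ℚ) :- con 1ℚ))
             refl (a (suc n)) u (ι n) (r n)) ⟩
    r n * r n * a (suc n) * (ι (suc n) ^ℚ 2 * u)
      ≡⟨ cong (r n * r n * a (suc n) *_) (sym (trans
           (ι-homo-* (suc n ℕ.^ 2) (4 ℕ.^ suc n)) (cong (_* u) (ι-homo-^ (suc n) 2)))) ⟩
    r n * r n * a (suc n) * ι d ∎)
    where
    open ≡-Reasoning
    d = suc n ℕ.^ 2 ℕ.* 4 ℕ.^ suc n
    u = ι (4 ℕ.^ suc n)
    d≢0 : NonZero d
    d≢0 = ℕₚ.m*n≢0 (suc n ℕ.^ 2) (4 ℕ.^ suc n) {{ℕₚ.m^n≢0 (suc n) 2}} {{ℕₚ.m^n≢0 4 (suc n)}}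

  -- Partial fraction expansion of the star sums.

  -- n!² / ((n - k)! (n + k)!), which is 0 for k > n.
  c : ℕ → ℕ → ℚ
  c n zero    = 1ℚ
  c n (suc k) = (ι n - ι k) * r (n ℕ.+ k) * c n k

  r-inverse-+ : ∀ n k → r (n ℕ.+ k) * (ι n + ι k + 1ℚ) ≡ 1ℚ
  r-inverse-+ n k =
    trans (cong (λ x → r (n ℕ.+ k) * (x + 1ℚ)) (sym (ι-homo-+ n k))) (r-inverse (n ℕ.+ k))

  c-vanishes : ∀ {n k} → n ℕ.< k → c n k ≡ 0ℚ
  c-vanishes {n} {suc k} (ℕ.s≤s n≤k) with ℕₚ.m≤n⇒m<n∨m≡n n≤k
  ... | inj₁ n<k  = trans (cong ((ι n - ι k) * r (n ℕ.+ k) *_) (c-vanishes n<k))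
      (ℚₚ.*-zeroʳ ((ι n - ι k) * r (n ℕ.+ k)))
  ... | inj₂ refl = solve 3 (λ x s y → (x :- x) :* s :* y := con 0ℚ) refl
    (ι n) (r (n ℕ.+ n)) (c n n)

  c-nonNeg : ∀ n k → 0ℚ ≤ c n k
  c-nonNeg n zero    = ℚₚ.<⇒≤ (ℚₚ.positive⁻¹ 1ℚ)
  c-nonNeg n (suc k) with ℕₚ.≤-<-connex k n
  ... | inj₁ k≤n = 0≤* (0≤* (p≤q⇒0≤q-p (ι-mono-≤ k≤n)) (0≤r (n ℕ.+ k))) (c-nonNeg n k)
  ... | inj₂ n<k = ℚₚ.≤-reflexive (sym (c-vanishes (ℕₚ.m<n⇒m<1+n n<k)))

  -- The values decrease in `k`: the drop from `c n k` to `c n (suc k)` is (2k+1)/(n+k+1) times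
  -- `c n k`.
  c≤1 : ∀ n k → c n k ≤ 1ℚ
  c≤1 n zero    = ℚₚ.≤-refl
  c≤1 n (suc k) = ℚₚ.≤-trans
    (≤-by-difference ((ι k + ι k + 1ℚ) * r (n ℕ.+ k) * c n k)
      (0≤* (0≤* (0≤+ (0≤+ (0≤ι k) (0≤ι k)) (ℚₚ.<⇒≤ (ℚₚ.positive⁻¹ 1ℚ))) (0≤r (n ℕ.+ k)))
        (c-nonNeg n k))
      (combination (- c n k · r-inverse-+ n k)
        (solve 4 (λ n k s c →
            c :- ((n :- k) :* s :* c :+ (k :+ k :+ con 1ℚ) :* s :* c)
            := (:- c) :* (s :* (n :+ k :+ con 1ℚ) :- con 1ℚ))
          refl (ι n) (ι k) (r (n ℕ.+ k)) (c n k))))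
    (c≤1 n k)

  c-step : ∀ n k → (ι n + ι k + 1ℚ) * c n (suc k) ≡ (ι n - ι k) * c n k
  c-step n k = combination ((ι n - ι k) * c n k · r-inverse-+ n k)
    (solve 4 (λ n k s c →
        (n :+ k :+ con 1ℚ) :* ((n :- k) :* s :* c) :- (n :- k) :* c
        := (n :- k) :* c :* (s :* (n :+ k :+ con 1ℚ) :- con 1ℚ))
      refl (ι n) (ι k) (r (n ℕ.+ k)) (c n k))

  -- In factorials, the ratio of `c n k` to `c (suc n) k` is ((n+1)² - k²)/(n+1)². Induction on `k`
  -- avoids factorials and covers k > n as well. After division by k², an increment in `n` produces
  -- the weight 1/(n+1)² of the star sum.
  c-difference : ∀ n k → c (suc n) k - c n k ≡ ι k * ι k * (r n * r n) * c (suc n) k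
  c-difference n zero    = solve 1 (λ ρ →
    con 1ℚ :- con 1ℚ := con 0ℚ :* con 0ℚ :* (ρ :* ρ) :* con 1ℚ) refl (r n)
  c-difference n (suc k) = combination
    ((x - y) * s · c-difference n k
      ⊞ - ((ρ * (x + 1ℚ) + 1ℚ) * e * ((x + 1ℚ - y) * s′ - (x - y) * s)) · r-inverse n
      ⊞ (x + 1ℚ - y) * (x - y) * e * (ρ * ρ) · r-inverse-+ (suc n) k
      ⊞ - ((x + 1ℚ - y) * (x - y) * e * (ρ * ρ)) · r-inverse-+ n k)
    (solve 7 (λ x y ρ s s′ e e₀ →
        (x :+ con 1ℚ :- y) :* s′ :* e :- (x :- y) :* s :* e₀
        :- (y :+ con 1ℚ) :* (y :+ con 1ℚ) :* (ρ :* ρ) :* ((x :+ con 1ℚ :- y) :* s′ :* e)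
        := (x :- y) :* s :* (e :- e₀ :- y :* y :* (ρ :* ρ) :* e)
          :+ ((:- ((ρ :* (x :+ con 1ℚ) :+ con 1ℚ) :* e
              :* ((x :+ con 1ℚ :- y) :* s′ :- (x :- y) :* s)))
            :* (ρ :* (x :+ con 1ℚ) :- con 1ℚ)
          :+ ((x :+ con 1ℚ :- y) :* (x :- y) :* e :* (ρ :* ρ)
            :* (s′ :* (x :+ con 1ℚ :+ y :+ con 1ℚ) :- con 1ℚ)
          :+ (:- ((x :+ con 1ℚ :- y) :* (x :- y) :* e :* (ρ :* ρ)))
            :* (s :* (x :+ y :+ con 1ℚ) :- con 1ℚ))))
      refl x y ρ s s′ e (c n k))
    where
    x = ι n
    y = ι k
    ρ = r n
    s = r (n ℕ.+ k)
    s′ = r (suc n ℕ.+ k)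
    e = c (suc n) k

  -1^-suc : ∀ n → -1^ (suc n) ≡ - -1^ n
  -1^-suc n = solve 1 (λ s → con (- 1ℚ) :* s := :- s) refl (-1^ n)

  -- With N = n+1, `c-step` turns (1 - k/N) c(k) into (N+k+1) c(k+1)/N. Adding (1 - (k+1)/N) c(k+1)
  -- gives 2 c(k+1), which is the induction step.
  alternating-c : ∀ n K →
    2ℚ * (∑[ i < K ] -1^ i * c (suc n) (suc i)) ≡ 1ℚ - -1^ K * ((1ℚ - ι K * r n) * c (suc n) K)
  alternating-c n zero    = solve 1 (λ ρ →
    con 2ℚ :* con 0ℚ := con 1ℚ :- con 1ℚ :* ((con 1ℚ :- con 0ℚ :* ρ) :* con 1ℚ)) refl (r n)
  alternating-c n (suc K) = combination
    (1ℚ · alternating-c n K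
      ⊞ σ * (e - e′) · r-inverse n
      ⊞ σ * ρ · c-step (suc n) K
      ⊞ (1ℚ - (y + 1ℚ) * ρ) * e′ · -1^-suc K)
    (solve 8 (λ S σ σ′ x y ρ e e′ →
        con 2ℚ :* (S :+ σ :* e′) :- (con 1ℚ :- σ′ :* ((con 1ℚ :- (y :+ con 1ℚ) :* ρ) :* e′))
        := con 1ℚ :* (con 2ℚ :* S :- (con 1ℚ :- σ :* ((con 1ℚ :- y :* ρ) :* e)))
          :+ (σ :* (e :- e′) :* (ρ :* (x :+ con 1ℚ) :- con 1ℚ)
          :+ (σ :* ρ :* ((x :+ con 1ℚ :+ y :+ con 1ℚ) :* e′ :- (x :+ con 1ℚ :- y) :* e)
          :+ (con 1ℚ :- (y :+ con 1ℚ) :* ρ) :* e′ :* (σ′ :- (:- σ)))))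
      refl (∑[ i < K ] -1^ i * c (suc n) (suc i)) σ (-1^ (suc K)) (ι n) y ρ e e′)
    where
    σ = -1^ K
    y = ι K
    ρ = r n
    e = c (suc n) K
    e′ = c (suc n) (suc K)

  telescope : ∀ n (f g : ℕ → ℚ) → f 0 ≡ 0ℚ → (∀ i → i ℕ.< n → f (suc i) - f i ≡ g i) → f n ≡ ∑< n g
  telescope zero    f g f0≡0 h = f0≡0
  telescope (suc n) f g f0≡0 h = combination
    (1ℚ · telescope n f g f0≡0 (λ i i<n → h i (ℕₚ.m<n⇒m<1+n i<n)) ⊞ 1ℚ · h n ℕₚ.≤-refl)
    (solve 4 (λ x y s d →
        x :- (s :+ d) := con 1ℚ :* (y :- s) :+ con 1ℚ :* (x :- y :- d)) refl
      (f (suc n)) (f n) (∑< n g) (g n))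

  -- The cut-off `K` is separate from `n`: terms with i ≥ n vanish, and a range shared by all n ≤ K
  -- lets sums over `n` and `i` be exchanged later.
  partialFraction : ℕ → ℕ → ℕ → ℚ
  partialFraction K n j = 2ℚ * (∑[ i < K ] -1^ i * (r i * r i) ^ℚ j * c n (suc i))

  partialFraction-0 : ∀ {n K} → suc n ℕ.≤ K → partialFraction K (suc n) 0 ≡ 1ℚ
  partialFraction-0 {n} {K} n<K = begin
    2ℚ * (∑[ i < K ] -1^ i * 1ℚ * c (suc n) (suc i))
      ≡⟨ cong (2ℚ *_) (∑-cong K (λ i → cong (_* c (suc n) (suc i)) (ℚₚ.*-identityʳ (-1^ i)))) ⟩
    2ℚ * (∑[ i < K ] -1^ i * c (suc n) (suc i))
      ≡⟨ alternating-c n K ⟩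
    1ℚ - -1^ K * ((1ℚ - ι K * r n) * c (suc n) K)
      ≡⟨ cong (λ x → 1ℚ - -1^ K * x) remainder≡0 ⟩
    1ℚ - -1^ K * 0ℚ
      ≡⟨ solve 1 (λ s → con 1ℚ :- s :* con 0ℚ := con 1ℚ) refl (-1^ K) ⟩
    1ℚ ∎
    where
    open ≡-Reasoning
    remainder≡0 : (1ℚ - ι K * r n) * c (suc n) K ≡ 0ℚ
    -- Beyond n+1 the factor `c` vanishes; at K = n+1 the linear factor does.
    remainder≡0 with ℕₚ.m≤n⇒m<n∨m≡n n<K
    ... | inj₁ 1+n<K = trans (cong ((1ℚ - ι K * r n) *_) (c-vanishes 1+n<K))
      (ℚₚ.*-zeroʳ (1ℚ - ι K * r n))
    ... | inj₂ refl  = combination (- c (suc n) K · r-inverse n)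
      (solve 3 (λ x ρ e → (con 1ℚ :- (x :+ con 1ℚ) :* ρ) :* e :- con 0ℚ
        := (:- e) :* (ρ :* (x :+ con 1ℚ) :- con 1ℚ)) refl (ι n) (r n) (c (suc n) K))

  -- The factor k² from `c-difference` cancels one of the j+1 factors k⁻², leaving the recurrence
  -- that defines `ζ⋆`.
  partialFraction-difference : ∀ K n j →
    partialFraction K (suc n) (suc j) - partialFraction K n (suc j)
      ≡ r n * r n * partialFraction K (suc n) j
  partialFraction-difference K n j = begin
    2ℚ * ∑< K f - 2ℚ * ∑< K g
      ≡⟨ solve 2 (λ x y → con 2ℚ :* x :- con 2ℚ :* y := con 2ℚ :* (x :- y)) refl (∑< K f) (∑< K g) ⟩
    2ℚ * (∑< K f - ∑< K g)
      ≡⟨ cong (2ℚ *_) (trans (sym (∑-distrib-- K f g)) (∑-cong K difference)) ⟩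
    2ℚ * (∑[ i < K ] r n * r n * h i)
      ≡⟨ cong (2ℚ *_) (sym (*-distrib-∑ K (r n * r n) h)) ⟩
    2ℚ * (r n * r n * ∑< K h)
      ≡⟨ solve 2 (λ ρ x → con 2ℚ :* (ρ :* ρ :* x) := ρ :* ρ :* (con 2ℚ :* x)) refl (r n) (∑< K h) ⟩
    r n * r n * (2ℚ * ∑< K h) ∎
    where
    open ≡-Reasoning
    f g h : ℕ → ℚ
    f i = -1^ i * (r i * r i) ^ℚ suc j * c (suc n) (suc i)
    g i = -1^ i * (r i * r i) ^ℚ suc j * c n (suc i)
    h i = -1^ i * (r i * r i) ^ℚ j * c (suc n) (suc i)
    difference : ∀ i → f i - g i ≡ r n * r n * h i
    difference i = combination
      (-1^ i * (r i * r i * (r i * r i) ^ℚ j) · c-difference n (suc i)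
        ⊞ -1^ i * (r i * r i) ^ℚ j * (r n * r n) * c (suc n) (suc i)
            * (r i * (ι i + 1ℚ) + 1ℚ) · r-inverse i)
      (solve 7 (λ σ p t x ρ e e₀ →
          σ :* (t :* t :* p) :* e :- σ :* (t :* t :* p) :* e₀ :- ρ :* ρ :* (σ :* p :* e)
          := σ :* (t :* t :* p) :* (e :- e₀ :- (x :+ con 1ℚ) :* (x :+ con 1ℚ) :* (ρ :* ρ) :* e)
            :+ σ :* p :* (ρ :* ρ) :* e :* (t :* (x :+ con 1ℚ) :+ con 1ℚ)
              :* (t :* (x :+ con 1ℚ) :- con 1ℚ))
        refl (-1^ i) ((r i * r i) ^ℚ j) (r i) (ι i) (r n) (c (suc n) (suc i)) (c n (suc i)))

  partialFraction-base : ∀ K j → partialFraction K 0 j ≡ 0ℚ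
  partialFraction-base K j = trans (cong (2ℚ *_) (trans
    (∑-cong K (λ i → trans
      (cong (-1^ i * (r i * r i) ^ℚ j *_) (c-vanishes {0} {suc i} (ℕ.s≤s ℕ.z≤n)))
      (ℚₚ.*-zeroʳ (-1^ i * (r i * r i) ^ℚ j))))
    (∑-zero K))) (ℚₚ.*-zeroʳ 2ℚ)

  recip^2≡ : ∀ n → recip^ (suc n) 2 ≡ r n * r n
  recip^2≡ n = trans (recip^≡r^ n 2) (cong (r n *_) (ℚₚ.*-identityʳ (r n)))

  -- Holds at n = 0 only for j > 0, hence the shift.
  ζ⋆-partialFraction : ∀ K j n → suc n ℕ.≤ K → ζ⋆ (suc n) j ≡ partialFraction K (suc n) j
  ζ⋆-partialFraction K zero    n n<K = sym (partialFraction-0 n<K)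
  ζ⋆-partialFraction K (suc j) n n<K = begin
    ∑₁ (λ m → recip^ m 2 * ζ⋆ m j) (suc n)
      ≡⟨ ∑₁≡∑ (λ m → recip^ m 2 * ζ⋆ m j) (suc n) ⟩
    (∑[ i < suc n ] recip^ (suc i) 2 * ζ⋆ (suc i) j)
      ≡⟨ sym (telescope (suc n) (λ i → partialFraction K i (suc j)) _
           (partialFraction-base K (suc j)) step) ⟩
    partialFraction K (suc n) (suc j) ∎
    where
    open ≡-Reasoning
    step : ∀ i → i ℕ.< suc n → partialFraction K (suc i) (suc j) - partialFraction K i (suc j)
      ≡ recip^ (suc i) 2 * ζ⋆ (suc i) j
    step i i<1+n = trans (partialFraction-difference K i j)
      (sym (cong₂ _*_ (recip^2≡ i)
        (ζ⋆-partialFraction K j i (ℕₚ.≤-trans i<1+n n<K))))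

  -- Decay of the central binomial probability.

  1-½r-nonNeg : ∀ n → 0ℚ ≤ 1ℚ - r n * ½
  1-½r-nonNeg n = subst (0ℚ ≤_)
    (solve 1 (λ ρ → (con 1ℚ :- ρ) :+ ρ :* con ½ := con 1ℚ :- ρ :* con ½) refl (r n))
    (0≤+ (p≤q⇒0≤q-p (r≤1 n)) (0≤* (0≤r n) (ℚₚ.nonNegative⁻¹ ½)))

  a-nonNeg : ∀ n → 0ℚ ≤ a n
  a-nonNeg zero    = ℚₚ.nonNegative⁻¹ 1ℚ
  a-nonNeg (suc n) = 0≤* (a-nonNeg n) (1-½r-nonNeg n)

  -- The bound O(n^(-1/2)) on `a`, stated without square roots.
  a²≤r : ∀ n → a n * a n ≤ r n
  a²≤r zero    = ℚₚ.≤-reflexive (trans (sym (r-inverse 0)) (ℚₚ.*-identityʳ (r 0)))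
  a²≤r (suc n) = ≤-by-difference
    -- The first summand is the induction hypothesis scaled by s². The second is ρ′ - s²ρ for ρ′ =
    -- 1/(n+2): since ρ′ = ρ/(1+ρ), it equals ρ′ρ²(3 - ρ)/4, written here as visibly nonnegative.
    ((ρ - a n * a n) * (s * s) + r (suc n) * (ρ * ρ) * (½ + (1ℚ - ρ) * (½ * ½)))
    (0≤+
      (0≤* (p≤q⇒0≤q-p (a²≤r n)) (0≤* (1-½r-nonNeg n) (1-½r-nonNeg n)))
      (0≤* (0≤* (0≤r (suc n)) (0≤* (0≤r n) (0≤r n)))
        (0≤+ (ℚₚ.nonNegative⁻¹ ½) (0≤* (p≤q⇒0≤q-p (r≤1 n)) (ℚₚ.nonNegative⁻¹ (½ * ½))))))
    (combination
      (s * s * ρ · r-inverse (suc n) ⊞ - (s * s * r (suc n)) · r-inverse n)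
      (solve 4 (λ a ρ ρ′ x →
          ρ′ :- (a :* (con 1ℚ :- ρ :* con ½) :* (a :* (con 1ℚ :- ρ :* con ½))
            :+ ((ρ :- a :* a) :* ((con 1ℚ :- ρ :* con ½) :* (con 1ℚ :- ρ :* con ½))
              :+ ρ′ :* (ρ :* ρ) :* (con ½ :+ (con 1ℚ :- ρ) :* (con (½ * ½)))))
          := (con 1ℚ :- ρ :* con ½) :* (con 1ℚ :- ρ :* con ½) :* ρ
              :* (ρ′ :* (x :+ con 1ℚ :+ con 1ℚ) :- con 1ℚ)
            :+ (:- ((con 1ℚ :- ρ :* con ½) :* (con 1ℚ :- ρ :* con ½) :* ρ′))
              :* (ρ :* (x :+ con 1ℚ) :- con 1ℚ))
        refl (a n) ρ (r (suc n)) (ι n)))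
    where
    ρ = r n
    s = 1ℚ - r n * ½

  -- Hitting probabilities of a random walk.

  -- C(2n, n + k) / 4ⁿ
  p : ℕ → ℕ → ℚ
  p n k = a n * c n k

  p-nonNeg : ∀ n k → 0ℚ ≤ p n k
  p-nonNeg n k = 0≤* (a-nonNeg n) (c-nonNeg n k)

  p≤a : ∀ n k → p n k ≤ a n
  p≤a n k = subst (p n k ≤_) (ℚₚ.*-identityʳ (a n))
    (ℚₚ.*-monoˡ-≤-nonNeg (a n) {{ℚ.nonNegative (a-nonNeg n)}} (c≤1 n k))

  -- For a walk whose position after n steps has distribution p n, and k ≥ 1,
  -- k H M k is the probability of reaching k within M steps, and Q M k that of
  -- not reaching it (reflection principle).
  H : ℕ → ℕ → ℚ
  H M k = ∑[ n < M ] r n * p (suc n) k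

  Q : ℕ → ℕ → ℚ
  Q M k = ∑[ i < k ] p M i + p M (suc i)

  -- The hitting time theorem: `k` is first reached at step M+1 with probability k/(M+1) times that
  -- of being at `k` then. Both sides vanish at k = 0, and their increments in `k` agree by
  -- `c-difference` and `c-step`.
  Q-difference : ∀ M k → Q M k - Q (suc M) k ≡ ι k * (r M * p (suc M) k)
  Q-difference M k = sym (trans
    (telescope k (λ k → ι k * (r M * p (suc M) k)) _ (ℚₚ.*-zeroˡ (r M * p (suc M) 0))
      (λ i _ → step i))
    (∑-distrib-- k (λ i → p M i + p M (suc i)) (λ i → p (suc M) i + p (suc M) (suc i))))
    where
    step : ∀ k → ι (suc k) * (r M * p (suc M) (suc k)) - ι k * (r M * p (suc M) k)
      ≡ (p M k + p M (suc k)) - (p (suc M) k + p (suc M) (suc k))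
    step k = combination
      (A · c-difference M k ⊞ A · c-difference M (suc k)
        ⊞ A * ρ * ρ * (½ + y) · c-step (suc M) k
        ⊞ - (A * ρ * (½ + y) * (e′ - e)) · r-inverse M)
      (solve 8 (λ A ρ x y e e′ e₀ e₀′ →
          (y :+ con 1ℚ) :* (ρ :* (A :* (con 1ℚ :- ρ :* con ½) :* e′))
            :- y :* (ρ :* (A :* (con 1ℚ :- ρ :* con ½) :* e))
            :- ((A :* e₀ :+ A :* e₀′)
              :- (A :* (con 1ℚ :- ρ :* con ½) :* e :+ A :* (con 1ℚ :- ρ :* con ½) :* e′))
          := A :* (e :- e₀ :- y :* y :* (ρ :* ρ) :* e)
            :+ (A :* (e′ :- e₀′ :- (y :+ con 1ℚ) :* (y :+ con 1ℚ) :* (ρ :* ρ) :* e′)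
            :+ (A :* ρ :* ρ :* (con ½ :+ y)
                :* ((x :+ con 1ℚ :+ y :+ con 1ℚ) :* e′ :- (x :+ con 1ℚ :- y) :* e)
            :+ (:- (A :* ρ :* (con ½ :+ y) :* (e′ :- e))) :* (ρ :* (x :+ con 1ℚ) :- con 1ℚ))))
        refl A ρ (ι M) y e e′ (c M k) (c M (suc k)))
      where
      A = a M
      ρ = r M
      y = ι k
      e = c (suc M) k
      e′ = c (suc M) (suc k)

  Q-0 : ∀ k → Q 0 (suc k) ≡ 1ℚ
  Q-0 k = trans (∑-head k (λ i → p 0 i + p 0 (suc i))) (trans
    (cong₂ _+_ (cong (λ x → 1ℚ * 1ℚ + 1ℚ * x) (c-vanishes {0} {1} (ℕ.s≤s ℕ.z≤n)))
      (trans (∑-cong k (λ i → cong₂ (λ x y → 1ℚ * x + 1ℚ * y)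
          (c-vanishes {0} {suc i} (ℕ.s≤s ℕ.z≤n))
          (c-vanishes {0} {suc (suc i)} (ℕ.s≤s ℕ.z≤n))))
        (∑-zero k)))
    refl)

  -- Adds up `Q-difference` over the first `M` steps, starting from `Q-0`.
  ι*H≡1-Q : ∀ M k → ι (suc k) * H M (suc k) ≡ 1ℚ - Q M (suc k)
  ι*H≡1-Q zero    k = trans (ℚₚ.*-zeroʳ (ι (suc k))) (sym (cong (λ q → 1ℚ - q) (Q-0 k)))
  ι*H≡1-Q (suc M) k = combination
    (1ℚ · ι*H≡1-Q M k ⊞ - 1ℚ · Q-difference M (suc k))
    (solve 5 (λ x h t q q′ →
        x :* (h :+ t) :- (con 1ℚ :- q′)
        := con 1ℚ :* (x :* h :- (con 1ℚ :- q)) :+ con (- 1ℚ) :* (q :- q′ :- x :* t))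
      refl (ι (suc k)) (H M (suc k)) (r M * p (suc M) (suc k)) (Q M (suc k)) (Q (suc M) (suc k)))

  Q-nonNeg : ∀ M k → 0ℚ ≤ Q M k
  Q-nonNeg M k = ∑-nonNeg k (λ i → 0≤+ (p-nonNeg M i) (p-nonNeg M (suc i)))

  Q≤ : ∀ M k → Q M k ≤ ι k * (a M + a M)
  Q≤ M zero    = ℚₚ.≤-reflexive (sym (ℚₚ.*-zeroˡ (a M + a M)))
  Q≤ M (suc k) = subst (Q M (suc k) ≤_)
    (solve 2 (λ x y → x :* y :+ y := (x :+ con 1ℚ) :* y) refl (ι k) (a M + a M))
    (ℚₚ.+-mono-≤ (Q≤ M k) (ℚₚ.+-mono-≤ (p≤a M k) (p≤a M (suc k))))

  gap : ℕ → ℕ → ℚ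
  gap M k = r k * Q M (suc k)

  H≡r-gap : ∀ M k → H M (suc k) ≡ r k - gap M k
  H≡r-gap M k = combination (r k · ι*H≡1-Q M k ⊞ - H M (suc k) · r-inverse k)
    (solve 4 (λ ρ x h q →
        h :- (ρ :- ρ :* q)
        := ρ :* ((x :+ con 1ℚ) :* h :- (con 1ℚ :- q))
          :+ (:- h) :* (ρ :* (x :+ con 1ℚ) :- con 1ℚ))
      refl (r k) (ι k) (H M (suc k)) (Q M (suc k)))

  gap-nonNeg : ∀ M k → 0ℚ ≤ gap M k
  gap-nonNeg M k = 0≤* (0≤r k) (Q-nonNeg M (suc k))

  -- `Q M (suc k)` consists of 2(k+1) probabilities, each at most `a M`; the factor 1/(k+1) makes
  -- the bound uniform in `k`.
  gap≤ : ∀ M k → gap M k ≤ a M + a M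
  gap≤ M k = ℚₚ.≤-trans
    (ℚₚ.*-monoˡ-≤-nonNeg (r k) {{ℚ.nonNegative (0≤r k)}} (Q≤ M (suc k)))
    (ℚₚ.≤-reflexive (combination ((a M + a M) · r-inverse k)
      (solve 3 (λ ρ x y → ρ :* ((x :+ con 1ℚ) :* y) :- y := y :* (ρ :* (x :+ con 1ℚ) :- con 1ℚ))
        refl (r k) (ι k) (a M + a M))))

  H-nonNeg : ∀ M k → 0ℚ ≤ H M k
  H-nonNeg M k = ∑-nonNeg M (λ n → 0≤* (0≤r n) (p-nonNeg (suc n) k))

  H≤r : ∀ M k → H M (suc k) ≤ r k
  H≤r M k = ≤-by-difference (gap M k) (gap-nonNeg M k)
    (trans (solve 2 (λ ρ g → ρ := ρ :- g :+ g) refl (r k) (gap M k))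
      (cong (_+ gap M k) (sym (H≡r-gap M k))))

  -- Coefficients of the two sides and their near cancellation in pairs.

  V : ℕ → ℕ → ℚ
  V M i = ∑[ n < M ] ι (suc i) * (r n * r n * p (suc n) (suc i))

  V-nonNeg : ∀ M i → 0ℚ ≤ V M i
  V-nonNeg M i = ∑-nonNeg M (λ n → 0≤* (0≤ι (suc i))
    (0≤* (0≤* (0≤r n) (0≤r n)) (p-nonNeg (suc n) (suc i))))

  -- Holds term by term: with N = n+1, `c-step` rearranges to k c(k) + (k+1) c(k+1) = N (c(k) -
  -- c(k+1)), which is then divided by N².
  V-consecutive : ∀ M i → V M i + V M (suc i) ≡ H M (suc i) - H M (suc (suc i))
  V-consecutive M i = trans (sym (∑-distrib-+ M _ _)) (trans (∑-cong M step)
    (∑-distrib-- M (λ n → r n * p (suc n) (suc i)) (λ n → r n * p (suc n) (suc (suc i)))))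
    where
    step : ∀ n →
      ι (suc i) * (r n * r n * p (suc n) (suc i))
        + ι (suc (suc i)) * (r n * r n * p (suc n) (suc (suc i)))
      ≡ r n * p (suc n) (suc i) - r n * p (suc n) (suc (suc i))
    step n = combination
      (ρ * A * ρ · c-step (suc n) (suc i) ⊞ - (ρ * A * (e′ - e)) · r-inverse n)
      (solve 6 (λ A ρ x y e e′ →
          y :* (ρ :* ρ :* (A :* e)) :+ (y :+ con 1ℚ) :* (ρ :* ρ :* (A :* e′))
            :- (ρ :* (A :* e) :- ρ :* (A :* e′))
          := ρ :* A :* ρ :* ((x :+ con 1ℚ :+ y :+ con 1ℚ) :* e′ :- (x :+ con 1ℚ :- y) :* e)
            :+ (:- (ρ :* A :* (e′ :- e))) :* (ρ :* (x :+ con 1ℚ) :- con 1ℚ))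
        refl A ρ (ι n) (ι (suc i)) e e′)
      where
      A = a (suc n)
      ρ = r n
      e = c (suc n) (suc i)
      e′ = c (suc n) (suc (suc i))

  -- By `V-consecutive`, `V M i` is at most `H M (suc i)`, because the two other terms only lower
  -- it.
  V≤r : ∀ M i → V M i ≤ r i
  V≤r M i = ℚₚ.≤-trans
    (≤-by-difference (H M (suc (suc i)) + V M (suc i))
      (0≤+ (H-nonNeg M (suc (suc i))) (V-nonNeg M (suc i)))
      (combination (- 1ℚ · V-consecutive M i)
        (solve 4 (λ v v′ h h′ →
            h :- (v :+ (h′ :+ v′)) := con (- 1ℚ) :* (v :+ v′ :- (h :- h′)))
          refl (V M i) (V M (suc i)) (H M (suc i)) (H M (suc (suc i))))))
    (H≤r M i)

  -- The argument of `r` carries both index shifts: the denominator l+i+2 is the sum of the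
  -- unshifted indices.
  F : ℕ → ℕ → ℚ
  F M i = ∑[ l < M ] -1^ l * r (suc (l ℕ.+ i))

  F-head : ∀ M i → F (suc M) i ≡ r (suc i) - F M (suc i)
  F-head M i = trans (∑-head M (λ l → -1^ l * r (suc (l ℕ.+ i)))) (combination
    (1ℚ · ∑-cong M {g = λ l → - 1ℚ * (-1^ l * r (suc (l ℕ.+ suc i)))}
        (λ l → trans (cong (λ k → -1^ (suc l) * r (suc k)) (sym (ℕₚ.+-suc l i)))
          (ℚₚ.*-assoc (- 1ℚ) (-1^ l) (r (suc (l ℕ.+ suc i)))))
      ⊞ - 1ℚ · *-distrib-∑ M (- 1ℚ) (λ l → -1^ l * r (suc (l ℕ.+ suc i))))
    (solve 4 (λ ρ t t′ f →
        con 1ℚ :* ρ :+ t :- (ρ :- f)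
        := con 1ℚ :* (t :- t′) :+ con (- 1ℚ) :* (con (- 1ℚ) :* f :- t′))
      refl (r (suc i)) _ _ (F M (suc i))))

  -- Leibniz bounds for an alternating sum. By `F-head` each bound at M+1 comes from the other one
  -- at `M`, so they are proved together.
  F-bounds : ∀ M i → 0ℚ ≤ F M i × F M i ≤ r (suc i)
  F-bounds zero    i = ℚₚ.≤-refl , 0≤r (suc i)
  F-bounds (suc M) i with F-bounds M (suc i)
  ... | 0≤F , F≤r =
    subst (0ℚ ≤_) (sym (F-head M i))
      (p≤q⇒0≤q-p (ℚₚ.≤-trans F≤r (r-antimono (ℕₚ.n≤1+n (suc i))))) ,
    ≤-by-difference (F M (suc i)) 0≤F (trans
      (solve 2 (λ x f → x := x :- f :+ f) refl (r (suc i)) (F M (suc i)))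
      (cong (_+ F M (suc i)) (sym (F-head M i))))

  D : ℕ → ℕ → ℚ
  D M i = V M i - (r i - 2ℚ * F M i)

  -- Splitting off the last term as well as the first in `F-head` evaluates `F M i + F M (suc i)` up
  -- to the term at l = M. The main parts 1/k - 1/(k+1) from `V` and from the replacement then
  -- cancel.
  D-consecutive : ∀ M i →
    D M i + D M (suc i) ≡ gap M (suc i) - gap M i - 2ℚ * (-1^ M * r (suc (M ℕ.+ i)))
  D-consecutive M i = combination
    (1ℚ · V-consecutive M i ⊞ 1ℚ · H≡r-gap M i ⊞ - 1ℚ · H≡r-gap M (suc i) ⊞ 2ℚ · F-head M i)
    (solve 11 (λ v v′ h h′ ρ ρ′ g g′ f f′ t →
        v :- (ρ :- con 2ℚ :* f) :+ (v′ :- (ρ′ :- con 2ℚ :* f′)) :- (g′ :- g :- con 2ℚ :* t)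
        := con 1ℚ :* (v :+ v′ :- (h :- h′)) :+ (con 1ℚ :* (h :- (ρ :- g))
          :+ (con (- 1ℚ) :* (h′ :- (ρ′ :- g′)) :+ con 2ℚ :* (f :+ t :- (ρ′ :- f′)))))
      refl (V M i) (V M (suc i)) (H M (suc i)) (H M (suc (suc i))) (r i) (r (suc i))
        (gap M i) (gap M (suc i)) (F M i) (F M (suc i)) (-1^ M * r (suc (M ℕ.+ i))))

  ∣-1^∣ : ∀ n → ∣ -1^ n ∣ ≡ 1ℚ
  ∣-1^∣ zero    = refl
  ∣-1^∣ (suc n) = trans (ℚₚ.∣p*q∣≡∣p∣*∣q∣ (- 1ℚ) (-1^ n))
    (trans (ℚₚ.*-identityˡ ∣ -1^ n ∣) (∣-1^∣ n))

  ∣-1^n*p∣≡∣p∣ : ∀ n q → ∣ -1^ n * q ∣ ≡ ∣ q ∣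
  ∣-1^n*p∣≡∣p∣ n q = trans (ℚₚ.∣p*q∣≡∣p∣*∣q∣ (-1^ n) q)
    (trans (cong (_* ∣ q ∣) (∣-1^∣ n)) (ℚₚ.*-identityˡ ∣ q ∣))

  ∣D-consecutive∣ : ∀ M i → ∣ D M i + D M (suc i) ∣ ≤ 2ℚ * a M + 2ℚ * r M
  ∣D-consecutive∣ M i = subst (λ x → ∣ x ∣ ≤ 2ℚ * a M + 2ℚ * r M) (sym (D-consecutive M i))
    (ℚₚ.≤-trans
      (ℚₚ.∣p-q∣≤∣p∣+∣q∣ (gap M (suc i) - gap M i) (2ℚ * (-1^ M * r (suc (M ℕ.+ i)))))
      (ℚₚ.+-mono-≤
        -- Both gaps lie between 0 and `2ℚ * a M`, so their difference costs only that much.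
        (∣p∣≤q (gap-gap≤ (suc i) i) (subst (_≤ 2ℚ * a M)
          (solve 2 (λ g g′ → g :- g′ := :- (g′ :- g)) refl (gap M i) (gap M (suc i)))
          (gap-gap≤ i (suc i))))
        (subst (_≤ 2ℚ * r M) (sym ∣2±r∣)
          (ℚₚ.*-monoˡ-≤-nonNeg 2ℚ (r-antimono (ℕₚ.m≤n⇒m≤1+n (ℕₚ.m≤m+n M i)))))))
    where
    gap-gap≤ : ∀ k l → gap M k - gap M l ≤ 2ℚ * a M
    gap-gap≤ k l = ℚₚ.≤-trans
      (≤-by-difference (gap M l) (gap-nonNeg M l)
        (solve 2 (λ g g′ → g := g :- g′ :+ g′) refl (gap M k) (gap M l)))
      (subst (gap M k ≤_) (solve 1 (λ x → x :+ x := con 2ℚ :* x) refl (a M)) (gap≤ M k))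
    ∣2±r∣ : ∣ 2ℚ * (-1^ M * r (suc (M ℕ.+ i))) ∣ ≡ 2ℚ * r (suc (M ℕ.+ i))
    ∣2±r∣ = trans (ℚₚ.∣p*q∣≡∣p∣*∣q∣ 2ℚ (-1^ M * r (suc (M ℕ.+ i))))
      (cong (2ℚ *_) (trans (∣-1^n*p∣≡∣p∣ M (r (suc (M ℕ.+ i))))
        (ℚₚ.0≤p⇒∣p∣≡p (0≤r (suc (M ℕ.+ i))))))

  ∣D∣≤2r : ∀ M i → ∣ D M i ∣ ≤ 2ℚ * r i
  ∣D∣≤2r M i = ∣p∣≤q
    (≤-by-difference (r i - V M i + 2ℚ * (r i - F M i))
      (0≤+ (p≤q⇒0≤q-p (V≤r M i)) (0≤* (ℚₚ.nonNegative⁻¹ 2ℚ)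
        (p≤q⇒0≤q-p (ℚₚ.≤-trans (proj₂ (F-bounds M i)) (r-antimono (ℕₚ.n≤1+n i))))))
      (solve 3 (λ v ρ f → con 2ℚ :* ρ
          := v :- (ρ :- con 2ℚ :* f) :+ (ρ :- v :+ con 2ℚ :* (ρ :- f)))
        refl (V M i) (r i) (F M i)))
    (≤-by-difference (r i + V M i + 2ℚ * F M i)
      (0≤+ (0≤+ (0≤r i) (V-nonNeg M i)) (0≤* (ℚₚ.nonNegative⁻¹ 2ℚ) (proj₁ (F-bounds M i))))
      (solve 3 (λ v ρ f → con 2ℚ :* ρ
          := (:- (v :- (ρ :- con 2ℚ :* f))) :+ (ρ :+ v :+ con 2ℚ :* f))
        refl (V M i) (r i) (F M i)))

  -- Writing D_i = (D_i + D_(i+1)) - D_(i+1) repeatedly trades the value at `i` for `T` pair sums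
  -- and the value at T+i, which `∣D∣≤2r` controls. `T` stays free so that the two errors can be
  -- balanced.
  ∣D∣≤ : ∀ M T i → ∣ D M i ∣ ≤ ι T * (2ℚ * a M + 2ℚ * r M) + 2ℚ * r (T ℕ.+ i)
  ∣D∣≤ M zero    i = subst (∣ D M i ∣ ≤_)
    (solve 2 (λ x y → y := con 0ℚ :* x :+ y) refl (2ℚ * a M + 2ℚ * r M) (2ℚ * r i))
    (∣D∣≤2r M i)
  ∣D∣≤ M (suc T) i = subst₂ _≤_
    (cong ∣_∣ (solve 2 (λ d d′ → d :+ d′ :- d′ := d) refl (D M i) (D M (suc i))))
    (trans
      (solve 3 (λ x t y → x :+ (t :* x :+ y) := (t :+ con 1ℚ) :* x :+ y) refl
        (2ℚ * a M + 2ℚ * r M) (ι T) (2ℚ * r (T ℕ.+ suc i)))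
      (cong (λ k → ι (suc T) * (2ℚ * a M + 2ℚ * r M) + 2ℚ * r k) (ℕₚ.+-suc T i)))
    (ℚₚ.≤-trans (ℚₚ.∣p-q∣≤∣p∣+∣q∣ (D M i + D M (suc i)) (D M (suc i)))
      (ℚₚ.+-mono-≤ (∣D-consecutive∣ M i) (∣D∣≤ M T (suc i))))

  -- The left side truncated at `M`.

  ^-2* : ∀ q n → q ^ℚ (2 ℕ.* n) ≡ (q * q) ^ℚ n
  ^-2* q zero    = refl
  ^-2* q (suc n) = trans (cong (λ k → q * q ^ℚ k) (ℕₚ.+-suc n (n ℕ.+ 0)))
    (trans (sym (ℚₚ.*-assoc q q (q ^ℚ (2 ℕ.* n)))) (cong (q * q *_) (^-2* q n)))

  -1^-2* : ∀ n → -1^ (2 ℕ.* n) ≡ 1ℚ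
  -1^-2* n = trans (^-2* (- 1ℚ) n) (1^n≡1 n)

  ∑*∑ : ∀ m n f g → ∑< m f * ∑< n g ≡ (∑[ i < m ] ∑[ k < n ] f i * g k)
  ∑*∑ m n f g = trans (ℚₚ.*-comm (∑< m f) (∑< n g)) (trans (*-distrib-∑ m (∑< n g) f)
    (∑-cong m (λ i → trans (ℚₚ.*-comm (∑< n g) (f i)) (*-distrib-∑ n (f i) g))))

  weight : ℕ → ℕ → ℚ
  weight j i = -1^ i * ((r i * r i) ^ℚ j * r i)

  -- The cut-off `M` in the partial fractions serves every n ≤ M, which gives a double sum over a
  -- square whose order is exchanged.
  lhs-partialSum : ∀ j M →
    ∑₁ (λ n → centralWeight n * ζ⋆ n j) M ≡ 2ℚ * (∑[ i < M ] weight j i * V M i)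
  lhs-partialSum j M = begin
    ∑₁ (λ n → centralWeight n * ζ⋆ n j) M
      ≡⟨ ∑₁≡∑ (λ n → centralWeight n * ζ⋆ n j) M ⟩
    (∑[ n < M ] centralWeight (suc n) * ζ⋆ (suc n) j)
      ≡⟨ ∑-cong-< M expand ⟩
    (∑[ n < M ] ∑[ i < M ] 2ℚ * (weight j i * term i n))
      ≡⟨ ∑-swap M M (λ n i → 2ℚ * (weight j i * term i n)) ⟩
    (∑[ i < M ] ∑[ n < M ] 2ℚ * (weight j i * term i n))
      ≡⟨ ∑-cong M (λ i → trans (sym (*-distrib-∑ M 2ℚ (λ n → weight j i * term i n)))
           (cong (2ℚ *_) (sym (*-distrib-∑ M (weight j i) (term i))))) ⟩
    (∑[ i < M ] 2ℚ * (weight j i * V M i))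
      ≡⟨ sym (*-distrib-∑ M 2ℚ (λ i → weight j i * V M i)) ⟩
    2ℚ * (∑[ i < M ] weight j i * V M i) ∎
    where
    open ≡-Reasoning
    term : ℕ → ℕ → ℚ
    term i n = ι (suc i) * (r n * r n * p (suc n) (suc i))
    expand : ∀ n → n ℕ.< M →
      centralWeight (suc n) * ζ⋆ (suc n) j ≡ (∑[ i < M ] 2ℚ * (weight j i * term i n))
    expand n n<M = begin
      centralWeight (suc n) * ζ⋆ (suc n) j
        ≡⟨ cong₂ _*_ (centralWeight≡ n) (ζ⋆-partialFraction M j n n<M) ⟩
      r n * r n * a (suc n) * (2ℚ * ∑< M f)
        ≡⟨ solve 2 (λ x y → x :* (con 2ℚ :* y) := x :* con 2ℚ :* y) refl
             (r n * r n * a (suc n)) (∑< M f) ⟩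
      r n * r n * a (suc n) * 2ℚ * ∑< M f
        ≡⟨ *-distrib-∑ M (r n * r n * a (suc n) * 2ℚ) f ⟩
      (∑[ i < M ] r n * r n * a (suc n) * 2ℚ * f i)
        -- A factor k⁻¹k is inserted: k⁻¹ completes `weight` and k belongs to `V`.
        ≡⟨ ∑-cong M (λ i → combination
             (- (r n * r n * a (suc n) * 2ℚ * f i) · r-inverse i)
             (solve 7 (λ ρ A σ q e t x →
                 ρ :* ρ :* A :* con 2ℚ :* (σ :* q :* e)
                   :- con 2ℚ :* (σ :* (q :* t) :* ((x :+ con 1ℚ) :* (ρ :* ρ :* (A :* e))))
                 := (:- (ρ :* ρ :* A :* con 2ℚ :* (σ :* q :* e)))
                   :* (t :* (x :+ con 1ℚ) :- con 1ℚ))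
               refl (r n) (a (suc n)) (-1^ i) ((r i * r i) ^ℚ j) (c (suc n) (suc i)) (r i) (ι i))) ⟩
      (∑[ i < M ] 2ℚ * (weight j i * term i n)) ∎
      where
      f : ℕ → ℚ
      f i = -1^ i * (r i * r i) ^ℚ j * c (suc n) (suc i)

  -- The right side truncated at `M`.

  geometric : ∀ w u v →
    (u + v) * (∑[ k < suc w ] -1^ k * u ^ℚ k * v ^ℚ (w ℕ.∸ k))
      ≡ v ^ℚ suc w + -1^ w * u ^ℚ suc w
  geometric zero    u v = solve 2 (λ u v →
    (u :+ v) :* (con 0ℚ :+ con 1ℚ :* con 1ℚ :* con 1ℚ)
    := v :* con 1ℚ :+ con 1ℚ :* (u :* con 1ℚ)) refl u v
  -- Raising `w` multiplies the old terms by `v` and adds one new term. Keeping u + v as a factor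
  -- avoids a division.
  geometric (suc w) u v = combination
    ((u + v) · shift ⊞ v · geometric w u v ⊞ v * u ^ℚ suc w · -1^-suc w
      ⊞ (u + v) * -1^ (suc w) * u ^ℚ suc w · cong (v ^ℚ_) (ℕₚ.n∸n≡0 w))
    (solve 9 (λ u v S S′ σ σ′ u′ v′ z →
        (u :+ v) :* (S′ :+ σ′ :* u′ :* z) :- (v :* v′ :+ σ′ :* (u :* u′))
        := (u :+ v) :* (S′ :- v :* S) :+ (v :* ((u :+ v) :* S :- (v′ :+ σ :* u′))
          :+ (v :* u′ :* (σ′ :- (:- σ)) :+ (u :+ v) :* σ′ :* u′ :* (z :- con 1ℚ))))
      refl u v S S′ (-1^ w) (-1^ (suc w)) (u ^ℚ suc w) (v ^ℚ suc w) (v ^ℚ (w ℕ.∸ w)))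
    where
    S S′ : ℚ
    S = ∑[ k < suc w ] -1^ k * u ^ℚ k * v ^ℚ (w ℕ.∸ k)
    S′ = ∑[ k < suc w ] -1^ k * u ^ℚ k * v ^ℚ (suc w ℕ.∸ k)
    shift : S′ ≡ v * S
    shift = trans
      (∑-cong-< (suc w) (λ k k<1+w → trans
        (cong (λ l → -1^ k * u ^ℚ k * v ^ℚ l) (ℕₚ.+-∸-assoc 1 (ℕₚ.≤-pred k<1+w)))
        (solve 3 (λ x v y → x :* (v :* y) := v :* (x :* y)) refl
          (-1^ k * u ^ℚ k) v (v ^ℚ (w ℕ.∸ k)))))
      (sym (*-distrib-∑ (suc w) v (λ k → -1^ k * u ^ℚ k * v ^ℚ (w ℕ.∸ k))))

  r+r : ∀ i l → r i + r l ≡ r i * r l * (ι l + ι i + 1ℚ + 1ℚ)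
  r+r i l = combination (- r l · r-inverse i ⊞ - r i · r-inverse l)
    (solve 4 (λ u v x y →
        u :+ v :- u :* v :* (y :+ x :+ con 1ℚ :+ con 1ℚ)
        := (:- v) :* (u :* (x :+ con 1ℚ) :- con 1ℚ) :+ (:- u) :* (v :* (y :+ con 1ℚ) :- con 1ℚ))
      refl (r i) (r l) (ι i) (ι l))

  -- Since r i + r l = r i r l (i + l + 2), the factor r i + r l in the geometric
  -- sum cancels against r i r l and leaves 1 / (i + l + 2).
  geometric-r : ∀ j i l →
    r i * r l * (∑[ k < suc (2 ℕ.* j) ] -1^ k * r i ^ℚ k * r l ^ℚ (2 ℕ.* j ℕ.∸ k))
      ≡ r (suc (l ℕ.+ i)) * (r i ^ℚ suc (2 ℕ.* j) + r l ^ℚ suc (2 ℕ.* j))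
  geometric-r j i l = combination
    (t · geometric w (r i) (r l) ⊞ - (t * G) · r+r i l ⊞ - (r i * r l * G) · t-inverse
      ⊞ t * r i ^ℚ suc w · -1^-2* j)
    (solve 9 (λ u v g t x y u′ v′ σ →
        u :* v :* g :- t :* (u′ :+ v′)
        := t :* ((u :+ v) :* g :- (v′ :+ σ :* u′))
          :+ ((:- (t :* g)) :* (u :+ v :- u :* v :* (y :+ x :+ con 1ℚ :+ con 1ℚ))
          :+ ((:- (u :* v :* g)) :* (t :* (y :+ x :+ con 1ℚ :+ con 1ℚ) :- con 1ℚ)
          :+ t :* u′ :* (σ :- con 1ℚ))))
      refl (r i) (r l) G t (ι i) (ι l) (r i ^ℚ suc w) (r l ^ℚ suc w) (-1^ w))
    where
    w = 2 ℕ.* j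
    t = r (suc (l ℕ.+ i))
    G = ∑[ k < suc w ] -1^ k * r i ^ℚ k * r l ^ℚ (w ℕ.∸ k)
    t-inverse : t * (ι l + ι i + 1ℚ + 1ℚ) ≡ 1ℚ
    t-inverse = trans (cong (λ x → t * (x + 1ℚ + 1ℚ)) (sym (ι-homo-+ l i)))
      (r-inverse (suc (l ℕ.+ i)))

  seq-η : ∀ s M → seq (η (suc s)) M ≡ (∑[ i < M ] -1^ i * r i ^ℚ suc s)
  seq-η s M = trans (∑₁≡∑ (ηTerm (suc s)) M)
    (∑-cong M (λ i → cong (-1^ i *_) (recip^≡r^ i (suc s))))

  seq-∑₀ᴿ : ∀ f n M → seq (∑₀ᴿ f n) M ≡ (∑[ k < suc n ] seq (f k) M)
  seq-∑₀ᴿ f zero    M = sym (ℚₚ.+-identityˡ (seq (f 0) M))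
  seq-∑₀ᴿ f (suc n) M = cong (_+ seq (f (suc n)) M) (seq-∑₀ᴿ f n M)

  -- These are the convolution terms in which both arguments of η are positive. For fixed `i` and
  -- `l`, `geometric-r` evaluates the sum over `k` as two terms exchanged by i ↔ l. Both have the
  -- same total, hence the factor 2, and the sum over `l` is `F`.
  interior : ∀ j M → let w = 2 ℕ.* j in
    (∑[ k < suc w ] -1^ (suc k) * seq (η (suc k)) M * seq (η (suc (w ℕ.∸ k))) M)
      ≡ - (2ℚ * (∑[ i < M ] -1^ i * r i ^ℚ suc w * F M i))
  interior j M = begin
    (∑[ k < suc w ] -1^ (suc k) * seq (η (suc k)) M * seq (η (suc (w ℕ.∸ k))) M)
      ≡⟨ ∑-cong (suc w) expand ⟩
    (∑[ k < suc w ] ∑[ i < M ] ∑[ l < M ] s i l * T i l k)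
      ≡⟨ ∑-swap (suc w) M (λ k i → ∑[ l < M ] s i l * T i l k) ⟩
    (∑[ i < M ] ∑[ k < suc w ] ∑[ l < M ] s i l * T i l k)
      ≡⟨ ∑-cong M (λ i → ∑-swap (suc w) M (λ k l → s i l * T i l k)) ⟩
    (∑[ i < M ] ∑[ l < M ] ∑[ k < suc w ] s i l * T i l k)
      ≡⟨ ∑-cong M (λ i → ∑-cong M (collect i)) ⟩
    (∑[ i < M ] ∑[ l < M ] - 1ℚ * X i l + - 1ℚ * X l i)
      ≡⟨ ∑-cong M (λ i → ∑-distrib-+ M (λ l → - 1ℚ * X i l) (λ l → - 1ℚ * X l i)) ⟩
    (∑[ i < M ] (∑[ l < M ] - 1ℚ * X i l) + (∑[ l < M ] - 1ℚ * X l i))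
      ≡⟨ ∑-distrib-+ M (λ i → ∑[ l < M ] - 1ℚ * X i l) (λ i → ∑[ l < M ] - 1ℚ * X l i) ⟩
    (∑[ i < M ] ∑[ l < M ] - 1ℚ * X i l) + (∑[ i < M ] ∑[ l < M ] - 1ℚ * X l i)
      ≡⟨ cong ((∑[ i < M ] ∑[ l < M ] - 1ℚ * X i l) +_) (∑-swap M M (λ i l → - 1ℚ * X l i)) ⟩
    (∑[ i < M ] ∑[ l < M ] - 1ℚ * X i l) + (∑[ i < M ] ∑[ l < M ] - 1ℚ * X i l)
      ≡⟨ cong (λ x → x + x) ∑∑X ⟩
    - 1ℚ * total + - 1ℚ * total
      ≡⟨ solve 1 (λ x → con (- 1ℚ) :* x :+ con (- 1ℚ) :* x := :- (con 2ℚ :* x)) refl total ⟩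
    - (2ℚ * total) ∎
    where
    open ≡-Reasoning
    w = 2 ℕ.* j
    P : ℕ → ℚ
    P i = r i ^ℚ suc w
    s : ℕ → ℕ → ℚ
    s i l = -1^ i * -1^ l * (- (r i * r l))
    T : ℕ → ℕ → ℕ → ℚ
    T i l k = -1^ k * r i ^ℚ k * r l ^ℚ (w ℕ.∸ k)
    X : ℕ → ℕ → ℚ
    X i l = -1^ i * P i * (-1^ l * r (suc (l ℕ.+ i)))
    total : ℚ
    total = ∑[ i < M ] -1^ i * P i * F M i

    expand : ∀ k → -1^ (suc k) * seq (η (suc k)) M * seq (η (suc (w ℕ.∸ k))) M
      ≡ (∑[ i < M ] ∑[ l < M ] s i l * T i l k)
    expand k = begin
      -1^ (suc k) * seq (η (suc k)) M * seq (η (suc (w ℕ.∸ k))) M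
        ≡⟨ cong₂ (λ x y → -1^ (suc k) * x * y) (seq-η k M) (seq-η (w ℕ.∸ k) M) ⟩
      -1^ (suc k) * ∑< M f * ∑< M g
        ≡⟨ ℚₚ.*-assoc (-1^ (suc k)) (∑< M f) (∑< M g) ⟩
      -1^ (suc k) * (∑< M f * ∑< M g)
        ≡⟨ cong (-1^ (suc k) *_) (∑*∑ M M f g) ⟩
      -1^ (suc k) * (∑[ i < M ] ∑[ l < M ] f i * g l)
        ≡⟨ *-distrib-∑ M (-1^ (suc k)) (λ i → ∑[ l < M ] f i * g l) ⟩
      (∑[ i < M ] -1^ (suc k) * (∑[ l < M ] f i * g l))
        ≡⟨ ∑-cong M (λ i → *-distrib-∑ M (-1^ (suc k)) (λ l → f i * g l)) ⟩
      (∑[ i < M ] ∑[ l < M ] -1^ (suc k) * (f i * g l))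
        ≡⟨ ∑-cong M (λ i → ∑-cong M (λ l →
             -- The shifted sign and one reciprocal from each η are moved into `s`, which does not
             -- depend on `k`.
             solve 7 (λ σ σ′ τ u v u′ v′ →
                 con (- 1ℚ) :* τ :* (σ :* (u :* u′) :* (σ′ :* (v :* v′)))
                 := σ :* σ′ :* (:- (u :* v)) :* (τ :* u′ :* v′))
               refl (-1^ i) (-1^ l) (-1^ k) (r i) (r l) (r i ^ℚ k) (r l ^ℚ (w ℕ.∸ k)))) ⟩
      (∑[ i < M ] ∑[ l < M ] s i l * T i l k) ∎
      where
      f g : ℕ → ℚ
      f i = -1^ i * r i ^ℚ suc k
      g l = -1^ l * r l ^ℚ suc (w ℕ.∸ k)

    collect : ∀ i l → (∑[ k < suc w ] s i l * T i l k) ≡ - 1ℚ * X i l + - 1ℚ * X l i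
    collect i l = trans (sym (*-distrib-∑ (suc w) (s i l) (T i l))) (combination
      (- (-1^ i * -1^ l) · geometric-r j i l
        ⊞ (-1^ i * -1^ l * P l) · cong (λ k → r (suc k)) (ℕₚ.+-comm i l))
      (solve 9 (λ σ σ′ u v g t t′ p p′ →
          σ :* σ′ :* (:- (u :* v)) :* g
            :- (con (- 1ℚ) :* (σ :* p :* (σ′ :* t)) :+ con (- 1ℚ) :* (σ′ :* p′ :* (σ :* t′)))
          := (:- (σ :* σ′)) :* (u :* v :* g :- t :* (p :+ p′))
            :+ σ :* σ′ :* p′ :* (t′ :- t))
        refl (-1^ i) (-1^ l) (r i) (r l) (∑< (suc w) (T i l))
          (r (suc (l ℕ.+ i))) (r (suc (i ℕ.+ l))) (P i) (P l)))

    ∑∑X : (∑[ i < M ] ∑[ l < M ] - 1ℚ * X i l) ≡ - 1ℚ * total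
    ∑∑X = trans
      (∑-cong M (λ i → trans (sym (*-distrib-∑ M (- 1ℚ) (X i)))
        (cong (- 1ℚ *_) (sym (*-distrib-∑ M (-1^ i * P i) (λ l → -1^ l * r (suc (l ℕ.+ i))))))))
      (sym (*-distrib-∑ M (- 1ℚ) (λ i → -1^ i * P i * F M i)))

  η-convolution : ℕ → ℕ → ℚ
  η-convolution N M = ∑[ k < suc N ] -1^ k * seq (η k) M * seq (η (N ℕ.∸ k)) M

  -- The end terms k = 0 and k = 2j+2 have positive sign and a factor η(0) = ½ each, so together
  -- they give η(2j+2), truncated at `M`. The rest is `interior`.
  η-convolution≡ : ∀ j M → η-convolution (2 ℕ.* j ℕ.+ 2) M
    ≡ (∑[ i < M ] weight j i * (r i - 2ℚ * F M i))
  η-convolution≡ j M = begin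
    η-convolution (w ℕ.+ 2) M
      ≡⟨ cong (λ N → η-convolution N M) (ℕₚ.+-comm w 2) ⟩
    ∑< (suc N) t
      ≡⟨ ∑-head N t ⟩
    1ℚ * ½ * e + ((∑[ k < suc w ] t (suc k)) + -1^ N * e * seq (η (w ℕ.∸ w)) M)
      ≡⟨ cong₂ (λ x y → 1ℚ * ½ * e + (x + -1^ N * e * y))
           (trans (∑-cong-< (suc w) (λ k k<1+w →
               cong (λ l → -1^ (suc k) * seq (η (suc k)) M * seq (η l) M)
                 (ℕₚ.+-∸-assoc 1 (ℕₚ.≤-pred k<1+w))))
             (interior j M))
           (cong (λ k → seq (η k) M) (ℕₚ.n∸n≡0 w)) ⟩
    1ℚ * ½ * e + (- (2ℚ * total) + -1^ N * e * ½)
      ≡⟨ combination (e * ½ · -1^-2* j)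
           (solve 3 (λ e x σ →
               con 1ℚ :* con ½ :* e :+ ((:- (con 2ℚ :* x))
                 :+ con (- 1ℚ) :* (con (- 1ℚ) :* σ) :* e :* con ½) :- (e :- con 2ℚ :* x)
               := e :* con ½ :* (σ :- con 1ℚ))
             refl e total (-1^ w)) ⟩
    e - 2ℚ * total
      ≡⟨ cong₂ _-_ (seq-η (suc w) M) (*-distrib-∑ M 2ℚ (λ i → -1^ i * r i ^ℚ suc w * F M i)) ⟩
    (∑[ i < M ] -1^ i * r i ^ℚ suc (suc w)) - (∑[ i < M ] 2ℚ * (-1^ i * r i ^ℚ suc w * F M i))
      ≡⟨ sym (∑-distrib-- M (λ i → -1^ i * r i ^ℚ suc (suc w))
           (λ i → 2ℚ * (-1^ i * r i ^ℚ suc w * F M i))) ⟩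
    (∑[ i < M ] -1^ i * r i ^ℚ suc (suc w) - 2ℚ * (-1^ i * r i ^ℚ suc w * F M i))
      ≡⟨ ∑-cong M (λ i → combination
           (-1^ i * (r i * r i - 2ℚ * (r i * F M i)) · ^-2* (r i) j)
           (solve 5 (λ σ u q q′ f →
               σ :* (u :* (u :* q)) :- con 2ℚ :* (σ :* (u :* q) :* f)
                 :- σ :* (q′ :* u) :* (u :- con 2ℚ :* f)
               := σ :* (u :* u :- con 2ℚ :* (u :* f)) :* (q :- q′))
             refl (-1^ i) (r i) (r i ^ℚ w) ((r i * r i) ^ℚ j) (F M i))) ⟩
    (∑[ i < M ] weight j i * (r i - 2ℚ * F M i)) ∎
    where
    open ≡-Reasoning
    w = 2 ℕ.* j
    N = suc (suc w)
    t : ℕ → ℚ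
    t k = -1^ k * seq (η k) M * seq (η (N ℕ.∸ k)) M
    e total : ℚ
    e = seq (η N) M
    total = ∑[ i < M ] -1^ i * r i ^ℚ suc w * F M i

  -- Estimate of the weighted sum of the differences.

  partialSum-difference : ∀ j M →
    ∑₁ (λ n → centralWeight n * ζ⋆ n j) M - 2ℚ * η-convolution (2 ℕ.* j ℕ.+ 2) M
      ≡ 2ℚ * (∑[ i < M ] weight j i * D M i)
  partialSum-difference j M = begin
    ∑₁ (λ n → centralWeight n * ζ⋆ n j) M - 2ℚ * η-convolution (2 ℕ.* j ℕ.+ 2) M
      ≡⟨ cong₂ (λ x y → x - 2ℚ * y) (lhs-partialSum j M) (η-convolution≡ j M) ⟩
    2ℚ * ∑< M f - 2ℚ * ∑< M g
      ≡⟨ solve 2 (λ x y → con 2ℚ :* x :- con 2ℚ :* y := con 2ℚ :* (x :- y)) refl (∑< M f) (∑< M g) ⟩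
    2ℚ * (∑< M f - ∑< M g)
      ≡⟨ cong (2ℚ *_) (sym (∑-distrib-- M f g)) ⟩
    2ℚ * (∑[ i < M ] f i - g i)
      ≡⟨ cong (2ℚ *_) (∑-cong M (λ i →
           solve 3 (λ x y z → x :* y :- x :* z := x :* (y :- z)) refl
             (weight j i) (V M i) (r i - 2ℚ * F M i))) ⟩
    2ℚ * (∑[ i < M ] weight j i * D M i) ∎
    where
    open ≡-Reasoning
    f g : ℕ → ℚ
    f i = weight j i * V M i
    g i = weight j i * (r i - 2ℚ * F M i)

  r≤ : ∀ {k q} → 1ℚ ≤ q * ι (suc k) → r k ≤ q
  r≤ {k} {q} h = subst₂ _≤_ (ℚₚ.*-identityʳ (r k))
    (combination (q · r-inverse k)
      (solve 3 (λ ρ q x → ρ :* (q :* (x :+ con 1ℚ)) :- q := q :* (ρ :* (x :+ con 1ℚ) :- con 1ℚ))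
        refl (r k) q (ι k)))
    (ℚₚ.*-monoˡ-≤-nonNeg (r k) {{ℚ.nonNegative (0≤r k)}} h)

  ^-nonNeg : ∀ {q} n → 0ℚ ≤ q → 0ℚ ≤ q ^ℚ n
  ^-nonNeg zero    0≤q = ℚₚ.nonNegative⁻¹ 1ℚ
  ^-nonNeg (suc n) 0≤q = 0≤* 0≤q (^-nonNeg n 0≤q)

  *≤1 : ∀ {p q} → 0ℚ ≤ p → p ≤ 1ℚ → q ≤ 1ℚ → p * q ≤ 1ℚ
  *≤1 {p} {q} 0≤p p≤1 q≤1 = ℚₚ.≤-trans
    (subst (p * q ≤_) (ℚₚ.*-identityʳ p) (ℚₚ.*-monoˡ-≤-nonNeg p {{ℚ.nonNegative 0≤p}} q≤1)) p≤1

  ^≤1 : ∀ {q} n → 0ℚ ≤ q → q ≤ 1ℚ → q ^ℚ n ≤ 1ℚ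
  ^≤1 zero    0≤q q≤1 = ℚₚ.≤-refl
  ^≤1 (suc n) 0≤q q≤1 = *≤1 0≤q q≤1 (^≤1 n 0≤q q≤1)

  r^*ι^≡1 : ∀ K s → r K ^ℚ s * ι (suc K ℕ.^ s) ≡ 1ℚ
  r^*ι^≡1 K s = trans (cong (r K ^ℚ s *_) (ι-homo-^ (suc K) s))
    (trans (sym (^-distrib-* (r K) (ι (suc K)) s))
      (trans (cong (_^ℚ s) (r-inverse K)) (1^n≡1 s)))

  r≤r^ : ∀ {K M} s → suc K ℕ.^ s ℕ.≤ suc M → r M ≤ r K ^ℚ s
  r≤r^ {K} {M} s K^s≤M = r≤ (subst (_≤ r K ^ℚ s * ι (suc M)) (r^*ι^≡1 K s)
    (ℚₚ.*-monoˡ-≤-nonNeg (r K ^ℚ s) {{ℚ.nonNegative (^-nonNeg s (0≤r K))}} (ι-mono-≤ K^s≤M)))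

  p²≤q²⇒p≤q : ∀ {p q} → 0ℚ ≤ q → p * p ≤ q * q → p ≤ q
  p²≤q²⇒p≤q {p} {q} 0≤q p²≤q² with p ℚₚ.≤? q
  ... | yes p≤q = p≤q
  ... | no  p≰q = contradiction (ℚₚ.≤-<-trans p²≤q² (ℚₚ.≤-<-trans
    (ℚₚ.*-monoˡ-≤-nonNeg q {{ℚ.nonNegative 0≤q}} (ℚₚ.<⇒≤ q<p))
    (ℚₚ.*-monoˡ-<-pos p {{ℚ.positive (ℚₚ.≤-<-trans 0≤q q<p)}} q<p))) (ℚₚ.<-irrefl refl)
    where
    q<p : q < p
    q<p = ℚₚ.≰⇒> p≰q

  -- Write κ for `r K`. The hypothesis gives r M ≤ κ⁸, and the square root implicit in `a²≤r` leaves
  -- a M ≤ κ⁴.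
  r^8≤ : ∀ {K M} → suc K ℕ.^ 8 ℕ.≤ M → r M ≤ r K ^ℚ 4 × a M ≤ r K ^ℚ 4
  r^8≤ {K} {M} K^8≤M =
    ℚₚ.≤-trans r≤δ² (subst (δ * δ ≤_) (ℚₚ.*-identityʳ δ)
      (ℚₚ.*-monoˡ-≤-nonNeg δ {{ℚ.nonNegative 0≤δ}} (^≤1 4 (0≤r K) (r≤1 K)))) ,
    p²≤q²⇒p≤q 0≤δ (ℚₚ.≤-trans (a²≤r M) r≤δ²)
    where
    δ = r K ^ℚ 4
    0≤δ = ^-nonNeg 4 (0≤r K)
    r≤δ² : r M ≤ δ * δ
    r≤δ² = subst (r M ≤_)
      (solve 1 (λ x →
          x :* (x :* (x :* (x :* (x :* (x :* (x :* (x :* con 1ℚ)))))))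
          := x :* (x :* (x :* (x :* con 1ℚ))) :* (x :* (x :* (x :* (x :* con 1ℚ)))))
        refl (r K))
      (r≤r^ 8 (ℕₚ.m≤n⇒m≤1+n K^8≤M))

  -- Takes T = (K+1)² = κ⁻² in `∣D∣≤`: the pair sums cost at most κ⁻²(2κ⁴ + 2κ⁴) = 4κ², and the
  -- remaining value at most 2κ².
  ∣D∣≤6κ² : ∀ {K M} → suc K ℕ.^ 8 ℕ.≤ M → ∀ i → ∣ D M i ∣ ≤ ι 6 * (r K * r K)
  ∣D∣≤6κ² {K} {M} K^8≤M i = ℚₚ.≤-trans (∣D∣≤ M (suc K ℕ.^ 2) i)
    (subst (ι (suc K ℕ.^ 2) * (2ℚ * a M + 2ℚ * r M) + 2ℚ * r (suc K ℕ.^ 2 ℕ.+ i) ≤_)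
      (combination (ι 4 * (r K * r K) · r^*ι^≡1 K 2)
        (solve 2 (λ ρ n →
            n :* (con 2ℚ :* (ρ :* (ρ :* (ρ :* (ρ :* con 1ℚ))))
                :+ con 2ℚ :* (ρ :* (ρ :* (ρ :* (ρ :* con 1ℚ)))))
              :+ con 2ℚ :* (ρ :* (ρ :* con 1ℚ)) :- con (ι 6) :* (ρ :* ρ)
            := con (ι 4) :* (ρ :* ρ) :* (ρ :* (ρ :* con 1ℚ) :* n :- con 1ℚ))
          refl (r K) (ι (suc K ℕ.^ 2))))
      (ℚₚ.+-mono-≤
        (ℚₚ.*-monoˡ-≤-nonNeg (ι (suc K ℕ.^ 2)) {{ℚ.nonNegative (0≤ι (suc K ℕ.^ 2))}}
          (ℚₚ.+-mono-≤
            (ℚₚ.*-monoˡ-≤-nonNeg 2ℚ (proj₂ (r^8≤ {K} K^8≤M)))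
            (ℚₚ.*-monoˡ-≤-nonNeg 2ℚ (proj₁ (r^8≤ {K} K^8≤M)))))
        (ℚₚ.*-monoˡ-≤-nonNeg 2ℚ (r≤r^ 2
          (ℕₚ.m≤n⇒m≤1+n (ℕₚ.m≤m+n (suc K ℕ.^ 2) i))))))

  ∣∑∣≤∑∣∣ : ∀ n f → ∣ ∑< n f ∣ ≤ (∑[ i < n ] ∣ f i ∣)
  ∣∑∣≤∑∣∣ zero    f = ℚₚ.≤-refl
  ∣∑∣≤∑∣∣ (suc n) f = ℚₚ.≤-trans (ℚₚ.∣p+q∣≤∣p∣+∣q∣ (∑< n f) (f n))
    (ℚₚ.+-monoˡ-≤ ∣ f n ∣ (∣∑∣≤∑∣∣ n f))

  ∑-mono-≤ : ∀ n {f g} → (∀ i → f i ≤ g i) → ∑< n f ≤ ∑< n g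
  ∑-mono-≤ zero    h = ℚₚ.≤-refl
  ∑-mono-≤ (suc n) h = ℚₚ.+-mono-≤ (∑-mono-≤ n h) (h n)

  ∑-const : ∀ n q → ∑< n (λ _ → q) ≡ ι n * q
  ∑-const zero    q = sym (ℚₚ.*-zeroˡ q)
  ∑-const (suc n) q = trans (cong (_+ q) (∑-const n q))
    (solve 2 (λ x q → x :* q :+ q := (x :+ con 1ℚ) :* q) refl (ι n) q)

  -- The tail telescopes through r (m + 1)² ≤ r m - r (m + 1).
  ∑-split-bound : ∀ K d {f A} → (∀ i → f i ≤ A) → (∀ i → f i ≤ 2ℚ * (r i * r i)) →
    ∑< (d ℕ.+ suc K) f ≤ ι (suc K) * A + 2ℚ * (r K - r (d ℕ.+ K))
  ∑-split-bound K zero {f} {A} f≤A f≤r² = subst (∑< (suc K) f ≤_)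
    (trans (∑-const (suc K) A)
      (solve 2 (λ x ρ → x := x :+ con 2ℚ :* (ρ :- ρ)) refl (ι (suc K) * A) (r K)))
    (∑-mono-≤ (suc K) f≤A)
  ∑-split-bound K (suc d) {f} {A} f≤A f≤r² = ℚₚ.≤-trans
    (ℚₚ.+-mono-≤ (∑-split-bound K d f≤A f≤r²)
      (subst (λ k → f (d ℕ.+ suc K) ≤ 2ℚ * (r k * r k)) (ℕₚ.+-suc d K) (f≤r² (d ℕ.+ suc K))))
    (≤-by-difference (2ℚ * (r (suc m) * (r m - r (suc m))))
      (0≤* (ℚₚ.nonNegative⁻¹ 2ℚ)
        (0≤* (0≤r (suc m)) (p≤q⇒0≤q-p (r-antimono (ℕₚ.n≤1+n m)))))
      (combination (- (2ℚ * r m) · r-inverse (suc m) ⊞ 2ℚ * r (suc m) · r-inverse m)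
        (solve 5 (λ x ρ ρ₀ ρ₁ n →
            x :+ con 2ℚ :* (ρ :- ρ₁)
              :- (x :+ con 2ℚ :* (ρ :- ρ₀) :+ con 2ℚ :* (ρ₁ :* ρ₁) :+ con 2ℚ :* (ρ₁ :* (ρ₀ :- ρ₁)))
            := (:- (con 2ℚ :* ρ₀)) :* (ρ₁ :* (n :+ con 1ℚ :+ con 1ℚ) :- con 1ℚ)
              :+ con 2ℚ :* ρ₁ :* (ρ₀ :* (n :+ con 1ℚ) :- con 1ℚ))
          refl (ι (suc K) * A) (r K) (r m) (r (suc m)) (ι m))))
    where
    m = d ℕ.+ K

  ∣weight∣≤r : ∀ j i → ∣ weight j i ∣ ≤ r i
  ∣weight∣≤r j i = subst (_≤ r i)
    (sym (trans (∣-1^n*p∣≡∣p∣ i ((r i * r i) ^ℚ j * r i))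
      (ℚₚ.0≤p⇒∣p∣≡p (0≤* (^-nonNeg j 0≤r²) (0≤r i)))))
    (subst ((r i * r i) ^ℚ j * r i ≤_) (ℚₚ.*-identityˡ (r i))
      (ℚₚ.*-monoʳ-≤-nonNeg (r i) {{ℚ.nonNegative (0≤r i)}}
        (^≤1 j 0≤r² (*≤1 (0≤r i) (r≤1 i) (r≤1 i)))))
    where
    0≤r² : 0ℚ ≤ r i * r i
    0≤r² = 0≤* (0≤r i) (0≤r i)

  ∣weight*D∣≤ : ∀ j M i {q} → ∣ D M i ∣ ≤ q → ∣ weight j i * D M i ∣ ≤ r i * q
  ∣weight*D∣≤ j M i {q} ∣D∣≤q = subst (_≤ r i * q)
    (sym (ℚₚ.∣p*q∣≡∣p∣*∣q∣ (weight j i) (D M i)))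
    (ℚₚ.≤-trans
      (ℚₚ.*-monoʳ-≤-nonNeg ∣ D M i ∣ {{ℚₚ.∣-∣-nonNeg (D M i)}} (∣weight∣≤r j i))
      (ℚₚ.*-monoˡ-≤-nonNeg (r i) {{ℚ.nonNegative (0≤r i)}} ∣D∣≤q))

  -- The first K+1 terms are at most 6κ² each and contribute 6κ. The others are bounded by 2/k²,
  -- whose tail contributes at most 2κ.
  ∣∑weight*D∣≤8κ : ∀ j {K M} → suc K ℕ.^ 8 ℕ.≤ M →
    ∣ ∑[ i < M ] weight j i * D M i ∣ ≤ ι 8 * r K
  ∣∑weight*D∣≤8κ j {K} {M} K^8≤M = ℚₚ.≤-trans (∣∑∣≤∑∣∣ M f)
    (subst (λ m → ∑< m (λ i → ∣ f i ∣) ≤ ι 8 * r K) (ℕₚ.m∸n+n≡m K<M)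
      (ℚₚ.≤-trans (∑-split-bound K d bound₁ bound₂)
        (≤-by-difference (2ℚ * r (d ℕ.+ K)) (0≤* (ℚₚ.nonNegative⁻¹ 2ℚ) (0≤r (d ℕ.+ K)))
          (combination (- (ι 6 * r K) · r-inverse K)
            (solve 3 (λ ρ ρ′ x →
                con (ι 8) :* ρ :- ((x :+ con 1ℚ) :* (con (ι 6) :* (ρ :* ρ))
                  :+ con 2ℚ :* (ρ :- ρ′) :+ con 2ℚ :* ρ′)
                := (:- (con (ι 6) :* ρ)) :* (ρ :* (x :+ con 1ℚ) :- con 1ℚ))
              refl (r K) (r (d ℕ.+ K)) (ι K))))))
    where
    f : ℕ → ℚ
    f i = weight j i * D M i
    K<M : suc K ℕ.≤ M
    K<M = ℕₚ.≤-trans (ℕₚ.m≤m*n (suc K) (suc K ℕ.^ 7) {{ℕₚ.m^n≢0 (suc K) 7}}) K^8≤M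
    d = M ℕ.∸ suc K
    bound₁ : ∀ i → ∣ f i ∣ ≤ ι 6 * (r K * r K)
    bound₁ i = ℚₚ.≤-trans (∣weight*D∣≤ j M i (∣D∣≤6κ² {K} K^8≤M i))
      (subst (r i * (ι 6 * (r K * r K)) ≤_) (ℚₚ.*-identityˡ (ι 6 * (r K * r K)))
        (ℚₚ.*-monoʳ-≤-nonNeg (ι 6 * (r K * r K))
          {{ℚ.nonNegative (0≤* (0≤ι 6) (0≤* (0≤r K) (0≤r K)))}} (r≤1 i)))
    bound₂ : ∀ i → ∣ f i ∣ ≤ 2ℚ * (r i * r i)
    bound₂ i = subst (∣ f i ∣ ≤_)
      (solve 1 (λ ρ → ρ :* (con 2ℚ :* ρ) := con 2ℚ :* (ρ :* ρ)) refl (r i))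
      (∣weight*D∣≤ j M i (∣D∣≤2r M i))

  -- Passage to the limit.

  archimedean : ∀ ε → 0ℚ < ε → ∃[ K ] r K ≤ ε
  archimedean (mkℚ (ℤ.+ 0)  _ _) (ℚ.*<* (ℤ.+<+ ()))
  archimedean (mkℚ -[1+ _ ] _ _) (ℚ.*<* ())
  -- The denominator of ε is d+1 and its numerator is at least 1, so 1/(d+1) ≤ ε.
  archimedean ε@(mkℚ +[1+ n ] d _) _ = d , r≤ (subst (1ℚ ≤_)
    (sym (trans (cong (_* ι (suc d)) (sym (ℚₚ.↥p/↧p≡p ε))) (a/b*ιb≡ιa (suc n) (suc d))))
    (ι-mono-≤ {1} {suc n} (ℕ.s≤s ℕ.z≤n)))

  -- Since `x` is Cauchy, its n-th approximation may stand in for its later ones.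
  ⟶-diagonal : ∀ x (s : ℕ → ℚ) → (∀ ε → 0ℚ < ε → ∃[ N ] (∀ n → N ℕ.≤ n → ∣ s n - seq x n ∣ ≤ ε)) →
    (λ n → fromℚ (s n)) ⟶ x
  ⟶-diagonal x s h ε 0<ε with h ε/4 0<ε/4 | cauchy x ε/4 0<ε/4
    where
    ε/4 = ε * (½ * ½)
    0<ε/4 : 0ℚ < ε/4
    0<ε/4 = subst (_< ε/4) (ℚₚ.*-zeroˡ (½ * ½)) (ℚₚ.*-monoˡ-<-pos (½ * ½) 0<ε)
  ... | N , near | N′ , close = N ℕ.⊔ N′ , λ n N⊔N′≤n →
    -- The two errors of ε/4 leave ε/2 as the uniform gap that `_<ᴿ_` demands.
    ε * ½ , subst (_< ε * ½) (ℚₚ.*-zeroˡ ½) (ℚₚ.*-monoˡ-<-pos ½ 0<ε) , N′ , λ m N′≤m →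
    subst (∣ s n - seq x m ∣ + ε * ½ ≤_)
      (solve 1 (λ ε → ε :* con (½ * ½) :+ ε :* con (½ * ½) :+ ε :* con ½ := ε) refl ε)
      (ℚₚ.+-monoˡ-≤ (ε * ½) (subst (λ y → ∣ y ∣ ≤ ε * (½ * ½) + ε * (½ * ½))
        (solve 3 (λ s x y → (s :- x) :+ (x :- y) := s :- y) refl (s n) (seq x n) (seq x m))
        (ℚₚ.≤-trans (ℚₚ.∣p+q∣≤∣p∣+∣q∣ (s n - seq x n) (seq x n - seq x m))
          (ℚₚ.+-mono-≤ (near n (ℕₚ.m⊔n≤o⇒m≤o N N′ N⊔N′≤n))
            (ℚₚ.<⇒≤ (close n m (ℕₚ.m⊔n≤o⇒n≤o N N′ N⊔N′≤n) N′≤m))))))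

  ⟶-scaled : ∀ q x (s t : ℕ → ℚ) → (∀ n → seq x n ≡ t n) →
    (∀ ε → 0ℚ < ε → ∃[ N ] (∀ n → N ℕ.≤ n → ∣ s n - q * t n ∣ ≤ ε)) →
    (λ n → fromℚ (s n)) ⟶ (fromℚ q *ᴿ x)
  ⟶-scaled q x s t x≡t h = ⟶-diagonal (fromℚ q *ᴿ x) s λ ε 0<ε →
    let N , near = h ε 0<ε in
    N , λ n N≤n → subst (λ y → ∣ s n - q * y ∣ ≤ ε) (sym (x≡t n)) (near n N≤n)

  ∣partialSum-difference∣≤16κ : ∀ j {K n} → suc K ℕ.^ 8 ℕ.≤ n →
    ∣ ∑₁ (λ n → centralWeight n * ζ⋆ n j) n - 2ℚ * η-convolution (2 ℕ.* j ℕ.+ 2) n ∣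
      ≤ 2ℚ * (ι 8 * r K)
  ∣partialSum-difference∣≤16κ j {K} {n} K^8≤n = ℚₚ.≤-trans
    (ℚₚ.≤-reflexive (trans (cong ∣_∣ (partialSum-difference j n))
      (ℚₚ.∣p*q∣≡∣p∣*∣q∣ 2ℚ (∑[ i < n ] weight j i * D n i))))
    (ℚₚ.*-monoˡ-≤-nonNeg 2ℚ (∣∑weight*D∣≤8κ j {K} K^8≤n))

  16κ-small : ∀ ε → 0ℚ < ε → ∃[ K ] 2ℚ * (ι 8 * r K) ≤ ε
  16κ-small ε 0<ε with archimedean (ε * q)
      (subst (_< ε * q) (ℚₚ.*-zeroˡ q) (ℚₚ.*-monoˡ-<-pos q 0<ε))
    where
    -- 1/16 undoes the constant 2 · 8.
    q = ½ * ½ * (½ * ½)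
  ... | K , r≤ε = K , subst (2ℚ * (ι 8 * r K) ≤_)
    (solve 1 (λ ε → con 2ℚ :* (con (ι 8) :* (ε :* con (½ * ½ * (½ * ½)))) := ε) refl ε)
    (ℚₚ.*-monoˡ-≤-nonNeg 2ℚ (ℚₚ.*-monoˡ-≤-nonNeg (ι 8) r≤ε))

open import Data.Nat using (_+_; _*_; _∸_)
open import Data.Integer using (+_)

proposition3p3 : (j : ℕ) →
    HasSum
    (λ n → centralWeight n ℚ.* ζ⋆ n j)
    (fromℚ (+ 2 ℚ./ 1) *ᴿ
    ∑₀ᴿ (λ k → fromℚ (-1^ k) *ᴿ η k *ᴿ η ((2 * j + 2) ∸ k)) (2 * j + 2))
-- The n-th rational representing the right side is twice the convolution of the η sums truncated at
-- n, so both sides are compared at the same truncation.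
proposition3p3 j = ⟶-scaled (+ 2 ℚ./ 1)
  (∑₀ᴿ (λ k → fromℚ (-1^ k) *ᴿ η k *ᴿ η ((2 * j + 2) ∸ k)) (2 * j + 2))
  (∑₁ (λ n → centralWeight n ℚ.* ζ⋆ n j)) (η-convolution (2 * j + 2))
  (seq-∑₀ᴿ (λ k → fromℚ (-1^ k) *ᴿ η k *ᴿ η ((2 * j + 2) ∸ k)) (2 * j + 2)) λ ε 0<ε →
  let K , 16κ≤ε = 16κ-small ε 0<ε in
  -- From this index on the error is at most 16/(K+1).
  suc K ℕ.^ 8 , λ n K^8≤n → ℚₚ.≤-trans (∣partialSum-difference∣≤16κ j {K} K^8≤n) 16κ≤ε
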